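{- Let $\mu$ be Lebesgue measure on $[0,1]$, for $t\in[0,1]$ let $t^0=[0,t]$ and $t^1=[1-t,1]$, and let $\mathcal{I}_0=\{a^0 : 0\le a\le 1\}$. Define on $\mathcal{I}_0$ the operations $a^0\oplus b^0=[\mu(a^0\cup b^1)]^0$ and $\neg a^0=[\mu([0,1]\setminus a^0)]^0$, and let $0=0^0=[0,0]$ and $1=1^0=[0,1]$. Then $(\mathcal{I}_0,\oplus,\neg,0,1)$ is an MV-algebra.
   Context: In $[\mu(X)]^0$ the real number $\mu(X)\in[0,1]$ plays the role of $t$, i.e. $[\mu(X)]^0=[0,\mu(X)]$. An MV-algebra is a structure $(A,\oplus,\neg,0,1)$ such that $(A,\oplus,0)$ is a commutative monoid with identity $0$, and for all $x,y\in A$: (i) $\neg(\neg x)=x$; (ii) $1\oplus x=1$; (iii) $x\oplus\neg 0=\neg 0$; (iv) $\neg(\neg x\oplus y)\oplus y=\neg(\neg y\oplus x)\oplus x$. -}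

module Defs where

open import Algebra.Bundles using (CommutativeMonoid)
open import Algebra.Core using (Op₁; Op₂)
open import Algebra.Definitions using (LeftZero; RightZero; Involutive; Congruent₁)
open import Algebra.Structures using (IsCommutativeMonoid)
open import Data.Nat.Base as ℕ using (ℕ; zero; suc)
import Data.Nat.Properties as ℕ
open import Data.Product.Base using (Σ-syntax; ∃₂; ∃-syntax; _×_; _,_; proj₁)
open import Data.Rational.Base as ℚ using (ℚ; 0ℚ; 1ℚ)
import Data.Rational.Properties as ℚ
open import Function.Base using (id)
open import Level using (0ℓ; _⊔_)
open import Relation.Binary.Core using (Rel)
open import Relation.Binary.PropositionalEquality using (_≡_; refl; sym; trans; cong; subst; subst₂)
open import Relation.Unary using (Pred; _∈_; _⊆_; _≐_; _∪_; _∖_)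

open import Algebra.Properties.CommutativeSemigroup
  (CommutativeMonoid.commutativeSemigroup ℚ.+-0-commutativeMonoid)
  using (interchange; xy∙z≈xz∙y)
open import Algebra.Properties.Group ℚ.+-0-group using (//-rightDividesˡ)

-- Real numbers as Cauchy sequences of rationals, ordered by eventual
-- comparison. As usual for this construction, ℝ is a setoid: two sequences
-- are the same real when each is ≤ the other.

Eventually : Pred ℕ 0ℓ → Set
Eventually P = ∃[ N ] ∀ n → N ℕ.≤ n → P n

IsCauchy : (ℕ → ℚ) → Set
IsCauchy x = ∀ ε → 0ℚ ℚ.< ε →
  ∃[ N ] ∀ m n → N ℕ.≤ m → N ℕ.≤ n → ℚ.∣ x m ℚ.- x n ∣ ℚ.< ε

record ℝ : Set where
  constructor mkℝ
  field
    seq    : ℕ → ℚ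
    cauchy : IsCauchy seq

open ℝ public

infix 4 _≤_ _<_ _≈_

record _≤_ (x y : ℝ) : Set where
  constructor mk≤
  field
    eventually≤ : ∀ ε → 0ℚ ℚ.< ε → Eventually λ n → seq x n ℚ.≤ seq y n ℚ.+ ε

record _<_ (x y : ℝ) : Set where
  constructor mk<
  field
    gap         : ℚ
    gap>0       : 0ℚ ℚ.< gap
    eventually< : Eventually λ n → seq x n ℚ.+ gap ℚ.≤ seq y n

open _≤_ public
open _<_ public

_≈_ : Rel ℝ 0ℓ
x ≈ y = x ≤ y × y ≤ x

split : ∀ {ε} → 0ℚ ℚ.< ε → ∃₂ λ δ η → 0ℚ ℚ.< δ × 0ℚ ℚ.< η × δ ℚ.+ η ≡ ε
split {ε} 0<ε with δ , 0<δ , δ<ε ← ℚ.<-dense 0<ε =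
  δ , ε ℚ.- δ , 0<δ ,
  subst (ℚ._< ε ℚ.- δ) (ℚ.+-inverseʳ δ) (ℚ.+-monoˡ-< (ℚ.- δ) δ<ε) ,
  trans (ℚ.+-comm δ _) (//-rightDividesˡ δ ε)

eventually₂ : ∀ {P Q R : Pred ℕ 0ℓ} → (∀ {n} → P n → Q n → R n) →
              Eventually P → Eventually Q → Eventually R
eventually₂ f (M , p) (N , q) = M ℕ.⊔ N , λ n M⊔N≤n →
  f (p n (ℕ.m⊔n≤o⇒m≤o M N M⊔N≤n)) (q n (ℕ.m⊔n≤o⇒n≤o M N M⊔N≤n))

fromℚ : ℚ → ℝ
fromℚ q .seq    _ = q
fromℚ q .cauchy ε 0<ε =
  0 , λ _ _ _ _ → subst (ℚ._< ε) (cong ℚ.∣_∣ (sym (ℚ.+-inverseʳ q))) 0<ε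

0ℝ 1ℝ : ℝ
0ℝ = fromℚ 0ℚ
1ℝ = fromℚ 1ℚ

infixl 6 _+_ _-_

_+_ : ℝ → ℝ → ℝ
(x + y) .seq n = seq x n ℚ.+ seq y n
(x + y) .cauchy ε 0<ε
  with δ , η , 0<δ , 0<η , δ+η≡ε ← split 0<ε
  with M , p ← cauchy x δ 0<δ
  with N , q ← cauchy y η 0<η = M ℕ.⊔ N , λ m n l k →
    subst₂ ℚ._<_ refl δ+η≡ε (ℚ.≤-<-trans (bound (seq x m) (seq y m) (seq x n) (seq y n))
      (ℚ.+-mono-<
        (p m n (ℕ.m⊔n≤o⇒m≤o M N l) (ℕ.m⊔n≤o⇒m≤o M N k))
        (q m n (ℕ.m⊔n≤o⇒n≤o M N l) (ℕ.m⊔n≤o⇒n≤o M N k))))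
  where
  bound : ∀ a b c d → ℚ.∣ a ℚ.+ b ℚ.- (c ℚ.+ d) ∣ ℚ.≤ ℚ.∣ a ℚ.- c ∣ ℚ.+ ℚ.∣ b ℚ.- d ∣
  bound a b c d = subst (λ z → ℚ.∣ z ∣ ℚ.≤ ℚ.∣ a ℚ.- c ∣ ℚ.+ ℚ.∣ b ℚ.- d ∣)
    (trans (interchange a (ℚ.- c) b (ℚ.- d)) (cong (a ℚ.+ b ℚ.+_) (sym (ℚ.neg-distrib-+ c d))))
    (ℚ.∣p+q∣≤∣p∣+∣q∣ (a ℚ.- c) (b ℚ.- d))

-_ : ℝ → ℝ
(- x) .seq n = ℚ.- seq x n
(- x) .cauchy ε 0<ε with N , p ← cauchy x ε 0<ε = N , λ m n l k →
  subst (ℚ._< ε)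
    (trans (sym (ℚ.∣-p∣≡∣p∣ _)) (cong ℚ.∣_∣ (ℚ.neg-distrib-+ (seq x m) (ℚ.- seq x n))))
    (p m n l k)

_-_ : ℝ → ℝ → ℝ
x - y = x + - y

fromℚ-mono-≤ : ∀ {p q} → p ℚ.≤ q → fromℚ p ≤ fromℚ q
fromℚ-mono-≤ {q = q} p≤q .eventually≤ ε 0<ε = 0 , λ _ _ →
  ℚ.≤-trans p≤q (subst (ℚ._≤ q ℚ.+ ε) (ℚ.+-identityʳ q) (ℚ.+-monoʳ-≤ q (ℚ.<⇒≤ 0<ε)))

≤-<-trans : ∀ {x y z} → x ≤ y → y < z → x < z
≤-<-trans {x} {y} {z} x≤y (mk< δ 0<δ y<z)
  with η , θ , 0<η , 0<θ , η+θ≡δ ← split 0<δ =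
  mk< θ 0<θ (eventually₂
    (λ {n} p q → ℚ.≤-trans (ℚ.+-monoˡ-≤ θ p)
      (subst (ℚ._≤ seq z n) (sym (reassoc (seq y n))) q))
    (eventually≤ x≤y η 0<η) y<z)
  where
  reassoc : ∀ a → a ℚ.+ η ℚ.+ θ ≡ a ℚ.+ δ
  reassoc a = trans (ℚ.+-assoc a η θ) (cong (a ℚ.+_) η+θ≡δ)

<+ε⇒≤ : ∀ {x y} → (∀ ε → 0ℝ < ε → x < y + ε) → x ≤ y
<+ε⇒≤ {x} h .eventually≤ ε 0<ε
  with mk< δ 0<δ (N , p) ←
    h (fromℚ ε) (mk< ε 0<ε (0 , λ _ _ → ℚ.≤-reflexive (ℚ.+-identityˡ ε))) =
  N , λ n N≤n → ℚ.≤-trans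
    (subst (ℚ._≤ seq x n ℚ.+ δ) (ℚ.+-identityʳ (seq x n)) (ℚ.+-monoʳ-≤ (seq x n) (ℚ.<⇒≤ 0<δ)))
    (p n N≤n)

≤⇒0≤- : ∀ {x y} → x ≤ y → 0ℝ ≤ y - x
≤⇒0≤- {x} {y} x≤y .eventually≤ ε 0<ε with N , p ← eventually≤ x≤y ε 0<ε = N , λ n N≤n →
  subst₂ ℚ._≤_ (ℚ.+-inverseʳ (seq x n))
    (xy∙z≈xz∙y (seq y n) ε (ℚ.- seq x n))
    (ℚ.+-monoˡ-≤ (ℚ.- seq x n) (p n N≤n))

0≤-⇒≤ : ∀ {x y} → 0ℝ ≤ y - x → x ≤ y
0≤-⇒≤ {x} {y} 0≤y-x .eventually≤ ε 0<ε with N , p ← eventually≤ 0≤y-x ε 0<ε = N , λ n N≤n →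
  subst₂ ℚ._≤_ (ℚ.+-identityˡ (seq x n))
    (trans (xy∙z≈xz∙y (seq y n ℚ.- seq x n) ε (seq x n))
      (cong (ℚ._+ ε) (//-rightDividesˡ (seq x n) (seq y n))))
    (ℚ.+-monoˡ-≤ (seq x n) (p n N≤n))

0≤-+ : ∀ {x y} → 0ℝ ≤ x → 0ℝ ≤ y → 0ℝ ≤ x + y
0≤-+ {x} {y} 0≤x 0≤y .eventually≤ ε 0<ε with δ , η , 0<δ , 0<η , δ+η≡ε ← split 0<ε =
  eventually₂
    (λ {n} p q → subst₂ ℚ._≤_ (ℚ.+-identityˡ 0ℚ)
      (trans
        (interchange (seq x n) δ (seq y n) η)
        (cong (seq x n ℚ.+ seq y n ℚ.+_) δ+η≡ε))
      (ℚ.+-mono-≤ p q))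
    (eventually≤ 0≤x δ 0<δ) (eventually≤ 0≤y η 0<η)

partialSum : (ℕ → ℝ) → ℕ → ℝ
partialSum f zero    = 0ℝ
partialSum f (suc n) = partialSum f n + f n

HasSum : (ℕ → ℝ) → ℝ → Set
HasSum f s = ∀ ε → 0ℝ < ε →
  Eventually λ n → partialSum f n < s + ε × s < partialSum f n + ε

IsInfimum : Pred ℝ 0ℓ → ℝ → Set
IsInfimum P m = (∀ x → P x → m ≤ x) × (∀ ε → 0ℝ < ε → ∃[ x ] P x × x < m + ε)

-- A countable cover of X by bounded open intervals (lo n , hi n), empty
-- ones (lo n ≈ hi n) being allowed.
record Cover (X : Pred ℝ 0ℓ) : Set where
  field
    lo hi  : ℕ → ℝ
    lo≤hi  : ∀ n → lo n ≤ hi n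
    covers : ∀ {x} → x ∈ X → ∃[ n ] lo n < x × x < hi n

  len : ℕ → ℝ
  len n = hi n - lo n

-- The total lengths of the covers of X having finite total length.
CoverLength : Pred ℝ 0ℓ → Pred ℝ 0ℓ
CoverLength X s = Σ[ C ∈ Cover X ] HasSum (Cover.len C) s

IsOuterMeasure : Pred ℝ 0ℓ → ℝ → Set
IsOuterMeasure X = IsInfimum (CoverLength X)

Icc : ℝ → ℝ → Pred ℝ 0ℓ
Icc a b x = a ≤ x × x ≤ b

[0,1] : Pred ℝ 0ℓ
[0,1] = Icc 0ℝ 1ℝ

-- Lebesgue's definition for subsets of [0,1]: X is measurable when its outer
-- measure μ*(X) equals its inner measure 1 - μ*([0,1] ∖ X), and μ(X) is this
-- common value. It is determined by X up to _≈_, being an infimum.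
record Measurable (X : Pred ℝ 0ℓ) : Set where
  field
    X⊆[0,1]    : X ⊆ [0,1]
    value      : ℝ
    outer      : IsOuterMeasure X value
    outerCompl : IsOuterMeasure ([0,1] ∖ X) (1ℝ - value)

μ : (X : Pred ℝ 0ℓ) → Measurable X → ℝ
μ X = Measurable.value

0≤partialSum : ∀ {f} → (∀ n → 0ℝ ≤ f n) → ∀ n → 0ℝ ≤ partialSum f n
0≤partialSum     0≤f zero    = fromℚ-mono-≤ ℚ.≤-refl
0≤partialSum {f} 0≤f (suc n) = 0≤-+ (0≤partialSum 0≤f n) (0≤f n)

0≤coverLength : ∀ {X s} → CoverLength X s → 0ℝ ≤ s
0≤coverLength (C , sum) = <+ε⇒≤ λ ε 0<ε →
  let N , p = sum ε 0<ε in
  ≤-<-trans (0≤partialSum (λ n → ≤⇒0≤- (lo≤hi n)) N) (proj₁ (p N ℕ.≤-refl))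
  where open Cover C

0≤outer : ∀ {X m} → IsOuterMeasure X m → 0ℝ ≤ m
0≤outer (_ , approx) = <+ε⇒≤ λ ε 0<ε →
  let s , c , s<m+ε = approx ε 0<ε in
  ≤-<-trans (0≤coverLength c) s<m+ε

μ∈[0,1] : ∀ {X} (X-meas : Measurable X) → μ X X-meas ∈ [0,1]
μ∈[0,1] X-meas =
  0≤outer (Measurable.outer X-meas) ,
  0≤-⇒≤ (0≤outer (Measurable.outerCompl X-meas))

infix 9 _⁰ _¹

_⁰ _¹ : ℝ → Pred ℝ 0ℓ
t ⁰ = Icc 0ℝ t
t ¹ = Icc (1ℝ - t) 1ℝ

record 𝓘₀ : Set₁ where
  field
    set         : Pred ℝ 0ℓ
    index       : ℝ
    index∈[0,1] : index ∈ [0,1]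
    set≐index⁰  : set ≐ index ⁰

open 𝓘₀ public

infix 4 _≈₀_

_≈₀_ : Rel 𝓘₀ 0ℓ
S ≈₀ T = set S ≐ set T

interval⁰ : (t : ℝ) → t ∈ [0,1] → 𝓘₀
interval⁰ t t∈[0,1] = record
  { set = t ⁰ ; index = t ; index∈[0,1] = t∈[0,1] ; set≐index⁰ = id , id }

[μ_∣_]⁰ : (X : Pred ℝ 0ℓ) → Measurable X → 𝓘₀
[μ X ∣ X-meas ]⁰ = interval⁰ (μ X X-meas) (μ∈[0,1] X-meas)

𝟎 𝟏 : 𝓘₀
𝟎 = interval⁰ 0ℝ (fromℚ-mono-≤ ℚ.≤-refl , fromℚ-mono-≤ (ℚ.nonNegative⁻¹ 1ℚ))
𝟏 = interval⁰ 1ℝ (fromℚ-mono-≤ (ℚ.nonNegative⁻¹ 1ℚ) , fromℚ-mono-≤ ℚ.≤-refl)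

UnionsMeasurable : Set
UnionsMeasurable = ∀ {a b} → a ∈ [0,1] → b ∈ [0,1] → Measurable (a ⁰ ∪ b ¹)

ComplementsMeasurable : Set
ComplementsMeasurable = ∀ {a} → a ∈ [0,1] → Measurable ([0,1] ∖ a ⁰)

module Operations (∪-meas : UnionsMeasurable) (∖-meas : ComplementsMeasurable) where

  infixl 6 _⊕_
  infix  8 ¬_

  _⊕_ : Op₂ 𝓘₀
  S ⊕ T = [μ index S ⁰ ∪ index T ¹ ∣ ∪-meas (index∈[0,1] S) (index∈[0,1] T) ]⁰

  ¬_ : Op₁ 𝓘₀
  ¬ S = [μ [0,1] ∖ index S ⁰ ∣ ∖-meas (index∈[0,1] S) ]⁰

record IsMVAlgebra {c ℓ} {A : Set c} (_≋_ : Rel A ℓ)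
                   (_⊕_ : Op₂ A) (¬_ : Op₁ A) (0# 1# : A) : Set (c ⊔ ℓ) where
  field
    isCommutativeMonoid : IsCommutativeMonoid _≋_ _⊕_ 0#
    ¬-cong              : Congruent₁ _≋_ ¬_
    ¬-involutive        : Involutive _≋_ ¬_
    1-zeroˡ             : LeftZero _≋_ 1# _⊕_
    ¬0-zeroʳ            : RightZero _≋_ (¬ 0#) _⊕_
    łukasiewicz         : ∀ x y → ((¬ ((¬ x) ⊕ y)) ⊕ y) ≋ ((¬ ((¬ y) ⊕ x)) ⊕ x)

{-# OPTIONS --safe #-}

-- Write m = min(1 , a + b) and r = 1 + a - m = max(a , 1 - b). Up to endpoints
-- a⁰ ∪ b¹ is [0 , a] ∪ [r , 1], of length m, and its complement is (a , r), of
-- length 1 - m; likewise [0,1] ∖ a⁰ has measure 1 - a. So a ↦ a⁰ carries the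
-- operations min(1 , a + b) and 1 - a of the standard MV-algebra to ⊕ and ¬.
--
-- The constructive content is that no cover is shorter than the intervals it
-- covers. Compactness is not available, but the total length of a cover is a
-- convergent sum: if the cover takes up less than the whole length of an
-- interval, then this is so for one of its two halves, and finitely many members
-- of the cover and a bound on the tail tell which. The halves shrink to a point
-- that no member of the cover contains.
module Submission where

open import Defs
open import Algebra.Core using (Op₁; Op₂)
open import Algebra.Structures.Biased using (isCommutativeMonoidˡ)
open import Data.Integer.Base as ℤ using (+_)
import Data.Integer.Properties as ℤ
open import Data.Nat.Base as ℕ using (ℕ; zero; suc)
import Data.Nat.Coprimality as Coprime
import Data.Nat.Properties as ℕ
open import Data.Product.Base using (Σ-syntax; ∃-syntax; _×_; _,_; proj₁; proj₂; swap)
open import Data.Rational.Base as ℚ using (ℚ; mkℚ; 0ℚ; 1ℚ; ½; *≤*)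
import Data.Rational.Properties as ℚ
import Data.Rational.Unnormalised.Base as ℚᵘ
import Data.Rational.Unnormalised.Properties as ℚᵘ
open import Data.Sum.Base using (_⊎_; inj₁; inj₂)
open import Level using (0ℓ)
import Relation.Binary.Construct.On as On
open import Relation.Binary.PropositionalEquality
  using (_≡_; refl; sym; trans; cong; cong₂; subst; subst₂)
open import Relation.Nullary using (contradiction) renaming (¬_ to infix 3 not_)
open import Relation.Nullary.Decidable using (dec⇒maybe)
open import Relation.Unary using (Pred; _∈_; _⊆_; _∪_; _∖_)
open import Relation.Unary.Relation.Binary.Equality using (≐-isEquivalence)
open import Tactic.RingSolver using (solve-∀)
open import Tactic.RingSolver.Core.AlmostCommutativeRing
  using (AlmostCommutativeRing; fromCommutativeRing)

-- Linear arithmetic over the rationals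

ℚ-ring : AlmostCommutativeRing 0ℓ 0ℓ
ℚ-ring = fromCommutativeRing ℚ.+-*-commutativeRing (λ x → dec⇒maybe (0ℚ ℚ.≟ x))

infixl 4 _⊹_

_⊹_ : ∀ {p q r s} → p ℚ.≤ q → r ℚ.≤ s → p ℚ.+ r ℚ.≤ q ℚ.+ s
_⊹_ = ℚ.+-mono-≤

-- Linear consequences of inequalities: add the hypotheses up, then compare
-- the differences of the two sides by the ring solver.
≤-by : ∀ {p q r s} → p ℚ.≤ q → q ℚ.- p ≡ s ℚ.- r → r ℚ.≤ s
≤-by {p} {q} {r} {s} p≤q eq =
  subst₂ ℚ._≤_ (cancel p r) (trans (regroup q p r) (trans (cong (ℚ._+ r) eq) (restore s r)))
    (ℚ.+-monoˡ-≤ (r ℚ.- p) p≤q)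
  where
  cancel : ∀ p r → p ℚ.+ (r ℚ.- p) ≡ r
  cancel = solve-∀ ℚ-ring
  regroup : ∀ q p r → q ℚ.+ (r ℚ.- p) ≡ q ℚ.- p ℚ.+ r
  regroup = solve-∀ ℚ-ring
  restore : ∀ s r → s ℚ.- r ℚ.+ r ≡ s
  restore = solve-∀ ℚ-ring

half+half : ∀ p → ½ ℚ.* p ℚ.+ ½ ℚ.* p ≡ p
half+half = solve-∀ ℚ-ring

half>0 : ∀ {p} → 0ℚ ℚ.< p → 0ℚ ℚ.< ½ ℚ.* p
half>0 {p} 0<p = ℚ.*-monoʳ-<-pos ½ 0<p

-- Archimedean property

fromℕ : ℕ → ℚ
fromℕ n = mkℚ (+ n) 0 (Coprime.sym (Coprime.1-coprimeTo n))

fromℕ-suc : ∀ n → fromℕ (suc n) ≡ fromℕ n ℚ.+ 1ℚ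
fromℕ-suc n = ℚ.toℚᵘ-injective (ℚᵘ.≃-trans (ℚᵘ.*≡* eq) (ℚᵘ.≃-sym (ℚ.toℚᵘ-homo-+ (fromℕ n) 1ℚ)))
  where
  eq : + suc n ℤ.* + 1 ≡ (+ n ℤ.* + 1 ℤ.+ + 1) ℤ.* + 1
  eq = cong (ℤ._* + 1) (trans (cong +_ (ℕ.+-comm 1 n)) (cong (ℤ._+ + 1) (sym (ℤ.*-identityʳ (+ n)))))

archimedean : ∀ p → ∃[ n ] p ℚ.≤ fromℕ n
archimedean (mkℚ (+ n) d _)        = n , *≤* (ℤ.*-monoˡ-≤-nonNeg (+ n) (ℤ.+≤+ (ℕ.s≤s ℕ.z≤n)))
archimedean p@(mkℚ (ℤ.-[1+ _ ]) _ _) = 0 , ℚ.<⇒≤ (ℚ.negative⁻¹ p)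

halvings : ℚ → ℕ → ℚ
halvings p zero    = p
halvings p (suc n) = ½ ℚ.* halvings p n

halvings≥0 : ∀ {p} → 0ℚ ℚ.≤ p → ∀ n → 0ℚ ℚ.≤ halvings p n
halvings≥0 0≤p zero    = 0≤p
halvings≥0 0≤p (suc n) = ℚ.*-monoˡ-≤-nonNeg ½ (halvings≥0 0≤p n)

halvings>0 : ∀ {p} → 0ℚ ℚ.< p → ∀ n → 0ℚ ℚ.< halvings p n
halvings>0 0<p zero    = 0<p
halvings>0 0<p (suc n) = half>0 (halvings>0 0<p n)

-- This is `n + 1 ≤ 2 ^ n` in disguise, and it yields a rate of convergence without powers. With
-- `h = halvings p n`, passing from `n` to `suc n` loses `(n + 1) h - (n + 2) h / 2 = n h / 2`,
-- which is nonnegative.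
halvings-bound : ∀ {p} → 0ℚ ℚ.≤ p → ∀ n → fromℕ (suc n) ℚ.* halvings p n ℚ.≤ p
halvings-bound {p} 0≤p zero    = ℚ.≤-reflexive (ℚ.*-identityˡ p)
halvings-bound {p} 0≤p (suc n) = ℚ.≤-trans
  (≤-by {0ℚ} {½ ℚ.* (fromℕ n ℚ.* halvings p n)}
    (ℚ.*-monoˡ-≤-nonNeg ½ (subst (ℚ._≤ fromℕ n ℚ.* halvings p n) (ℚ.*-zeroʳ (fromℕ n))
      (ℚ.*-monoˡ-≤-nonNeg (fromℕ n) (halvings≥0 0≤p n))))
    (trans (eq (fromℕ n) (halvings p n))
      (cong₂ (λ a b → a ℚ.* halvings p n ℚ.- b ℚ.* (½ ℚ.* halvings p n))
        (sym (fromℕ-suc n))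
        (sym (trans (fromℕ-suc (suc n)) (cong (ℚ._+ 1ℚ) (fromℕ-suc n)))))))
  (halvings-bound 0≤p n)
  where
  eq : ∀ k h → ½ ℚ.* (k ℚ.* h) ℚ.- 0ℚ ≡ (k ℚ.+ 1ℚ) ℚ.* h ℚ.- (k ℚ.+ 1ℚ ℚ.+ 1ℚ) ℚ.* (½ ℚ.* h)
  eq = solve-∀ ℚ-ring

halvings-antitone : ∀ {p} → 0ℚ ℚ.≤ p → ∀ {m n} → m ℕ.≤′ n → halvings p n ℚ.≤ halvings p m
halvings-antitone 0≤p ℕ.≤′-refl = ℚ.≤-refl
halvings-antitone {p} 0≤p {m} (ℕ.≤′-step {n} m≤n) = ℚ.≤-trans
  (≤-by (halvings≥0 0≤p (suc n)) (eq (halvings p n)))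
  (halvings-antitone 0≤p m≤n)
  where
  eq : ∀ h → ½ ℚ.* h ℚ.- 0ℚ ≡ h ℚ.- ½ ℚ.* h
  eq = solve-∀ ℚ-ring

-- Take `k ≥ p / ε`. Then `(k + 1) * halvings p k ≤ p ≤ k ε ≤ (k + 1) ε`, and the factor `k + 1`
-- cancels; later halvings are smaller still.
halvings→0 : ∀ {p} → 0ℚ ℚ.≤ p → ∀ {ε} → 0ℚ ℚ.< ε → Eventually λ n → halvings p n ℚ.≤ ε
halvings→0 {p} 0≤p {ε} 0<ε with k , p/ε≤k ← archimedean (p ℚ.* (ℚ.1/ ε) {{ℚ.>-nonZero 0<ε}}) =
  k , λ n k≤n → ℚ.≤-trans (halvings-antitone 0≤p (ℕ.≤⇒≤′ k≤n))
    (ℚ.*-cancelˡ-≤-pos (fromℕ (suc k)) (begin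
      fromℕ (suc k) ℚ.* halvings p k  ≤⟨ halvings-bound 0≤p k ⟩
      p                               ≡⟨ ℚ.*-identityʳ p ⟨
      p ℚ.* 1ℚ                        ≡⟨ cong (p ℚ.*_) (ℚ.*-inverseˡ ε) ⟨
      p ℚ.* (ℚ.1/ ε ℚ.* ε)            ≡⟨ ℚ.*-assoc p (ℚ.1/ ε) ε ⟨
      p ℚ.* ℚ.1/ ε ℚ.* ε              ≤⟨ ℚ.*-monoʳ-≤-nonNeg ε p/ε≤k ⟩
      fromℕ k ℚ.* ε                   ≤⟨ ≤-by (ℚ.<⇒≤ 0<ε) (eq (fromℕ k) ε) ⟩
      (fromℕ k ℚ.+ 1ℚ) ℚ.* ε          ≡⟨ cong (ℚ._* ε) (fromℕ-suc k) ⟨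
      fromℕ (suc k) ℚ.* ε             ∎))
  where
  open ℚ.≤-Reasoning
  instance
    ε-pos : ℚ.Positive ε
    ε-pos = ℚ.positive 0<ε
    ε-nonNeg : ℚ.NonNegative ε
    ε-nonNeg = ℚ.nonNegative (ℚ.<⇒≤ 0<ε)
    ε-nonZero : ℚ.NonZero ε
    ε-nonZero = ℚ.>-nonZero 0<ε
  eq : ∀ k ε → ε ℚ.- 0ℚ ≡ (k ℚ.+ 1ℚ) ℚ.* ε ℚ.- k ℚ.* ε
  eq = solve-∀ ℚ-ring

-- Absolute values and minima of rationals

p≤∣p∣ : ∀ p → p ℚ.≤ ℚ.∣ p ∣
p≤∣p∣ p with ℚ.≤-total 0ℚ p
... | inj₁ 0≤p = ℚ.≤-reflexive (sym (ℚ.0≤p⇒∣p∣≡p 0≤p))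
... | inj₂ p≤0 = ℚ.≤-trans p≤0 (ℚ.0≤∣p∣ p)

∣p-q∣<r⇒p<q+r : ∀ {p q r} → ℚ.∣ p ℚ.- q ∣ ℚ.< r → p ℚ.< q ℚ.+ r
∣p-q∣<r⇒p<q+r {p} {q} {r} ∣p-q∣<r = subst (ℚ._< q ℚ.+ r) (eq q p)
  (ℚ.+-monoʳ-< q (ℚ.≤-<-trans (p≤∣p∣ (p ℚ.- q)) ∣p-q∣<r))
  where
  eq : ∀ q p → q ℚ.+ (p ℚ.- q) ≡ p
  eq = solve-∀ ℚ-ring

p<q+r⇒∣p-q∣<r : ∀ {p q r} → p ℚ.< q ℚ.+ r → q ℚ.< p ℚ.+ r → ℚ.∣ p ℚ.- q ∣ ℚ.< r
p<q+r⇒∣p-q∣<r {p} {q} {r} p<q+r q<p+r with ℚ.∣p∣≡p∨∣p∣≡-p (p ℚ.- q)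
... | inj₁ eq = subst₂ ℚ._<_ (sym eq) (cancel q r) (ℚ.+-monoˡ-< (ℚ.- q) p<q+r)
  where
  cancel : ∀ q r → q ℚ.+ r ℚ.- q ≡ r
  cancel = solve-∀ ℚ-ring
... | inj₂ eq = subst₂ ℚ._<_ (trans (flip q p) (sym eq)) (cancel p r) (ℚ.+-monoˡ-< (ℚ.- p) q<p+r)
  where
  flip : ∀ q p → q ℚ.- p ≡ ℚ.- (p ℚ.- q)
  flip = solve-∀ ℚ-ring
  cancel : ∀ q r → q ℚ.+ r ℚ.- q ≡ r
  cancel = solve-∀ ℚ-ring

ℚ-<⇒≱ : ∀ {p q} → p ℚ.< q → not q ℚ.≤ p
ℚ-<⇒≱ p<q q≤p = ℚ.<-irrefl refl (ℚ.<-≤-trans p<q q≤p)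

p≤p+q : ∀ p {q} → 0ℚ ℚ.≤ q → p ℚ.≤ p ℚ.+ q
p≤p+q p {q} 0≤q = subst (ℚ._≤ p ℚ.+ q) (ℚ.+-identityʳ p) (ℚ.+-monoʳ-≤ p 0≤q)

⊓>0 : ∀ p q → 0ℚ ℚ.< p → 0ℚ ℚ.< q → 0ℚ ℚ.< p ℚ.⊓ q
⊓>0 p q 0<p 0<q with ℚ.⊓-sel p q
... | inj₁ eq = subst (0ℚ ℚ.<_) (sym eq) 0<p
... | inj₂ eq = subst (0ℚ ℚ.<_) (sym eq) 0<q

p≤q⇒0≤q-p : ∀ {p q} → p ℚ.≤ q → 0ℚ ℚ.≤ q ℚ.- p
p≤q⇒0≤q-p {p} {q} p≤q = ≤-by p≤q (eq q p)
  where
  eq : ∀ q p → q ℚ.- p ≡ q ℚ.- p ℚ.- 0ℚ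
  eq = solve-∀ ℚ-ring

-- Eventual statements

always : ∀ {P : ℕ → Set} → (∀ n → P n) → Eventually P
always p = 0 , λ n _ → p n

eventually-map : ∀ {P Q : ℕ → Set} → (∀ {n} → P n → Q n) → Eventually P → Eventually Q
eventually-map f (N , p) = N , λ n N≤n → f (p n N≤n)

infixr 3 _&_

_&_ : ∀ {P Q : ℕ → Set} → Eventually P → Eventually Q → Eventually (λ n → P n × Q n)
_&_ {P} {Q} = eventually₂ {P} {Q} _,_

eventually⇒∃ : ∀ {P : ℕ → Set} → Eventually P → ∃[ n ] P n
eventually⇒∃ (N , p) = N , p N ℕ.≤-refl

-- Order and minimum on ℝ

-- Lets the single rational `seq x i` stand for `x` at a cost of `η`, so that questions about
-- several reals can be decided by comparing rationals at one common index.
Settled : ℝ → ℚ → ℕ → Set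
Settled x η i = ∀ j → i ℕ.≤ j → seq x i ℚ.≤ seq x j ℚ.+ η × seq x j ℚ.≤ seq x i ℚ.+ η

eventually-settled : ∀ x {η} → 0ℚ ℚ.< η → Eventually (Settled x η)
eventually-settled x {η} 0<η with N , close ← cauchy x η 0<η =
  N , λ i N≤i j i≤j → let N≤j = ℕ.≤-trans N≤i i≤j in
    ℚ.<⇒≤ (∣p-q∣<r⇒p<q+r (close i j N≤i N≤j)) , ℚ.<⇒≤ (∣p-q∣<r⇒p<q+r (close j i N≤j N≤i))

pointwise-≤ : ∀ {x y} → (∀ n → seq x n ℚ.≤ seq y n) → x ≤ y
pointwise-≤ {x} {y} x≤y .eventually≤ ε 0<ε =
  always λ n → ℚ.≤-trans (x≤y n) (p≤p+q (seq y n) (ℚ.<⇒≤ 0<ε))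

pointwise-≈ : ∀ {x y} → (∀ n → seq x n ≡ seq y n) → x ≈ y
pointwise-≈ eq =
  pointwise-≤ (λ n → ℚ.≤-reflexive (eq n)) , pointwise-≤ (λ n → ℚ.≤-reflexive (sym (eq n)))

fromℚ>0 : ∀ {p} → 0ℚ ℚ.< p → 0ℝ < fromℚ p
fromℚ>0 {p} 0<p = mk< p 0<p (always λ _ → ℚ.≤-reflexive (ℚ.+-identityˡ p))

eventually-≤ : ∀ {x y} → Eventually (λ i → seq x i ℚ.≤ seq y i) → x ≤ y
eventually-≤ {x} {y} x≤y .eventually≤ ε 0<ε =
  eventually-map (λ {n} p → ℚ.≤-trans p (p≤p+q (seq y n) (ℚ.<⇒≤ 0<ε))) x≤y

≤-refl : ∀ {x} → x ≤ x
≤-refl = pointwise-≤ λ _ → ℚ.≤-refl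

≤-trans : ∀ {x y z} → x ≤ y → y ≤ z → x ≤ z
≤-trans {x} {y} {z} x≤y y≤z .eventually≤ ε 0<ε =
  eventually₂ {λ n → seq x n ℚ.≤ seq y n ℚ.+ ½ ℚ.* ε} {λ n → seq y n ℚ.≤ seq z n ℚ.+ ½ ℚ.* ε}
    (λ {n} p q → ≤-by (p ⊹ q) (eq (seq x n) (seq y n) (seq z n) ε))
    (eventually≤ x≤y _ (half>0 0<ε)) (eventually≤ y≤z _ (half>0 0<ε))
  where
  eq : ∀ x y z ε → y ℚ.+ ½ ℚ.* ε ℚ.+ (z ℚ.+ ½ ℚ.* ε) ℚ.- (x ℚ.+ y) ≡ z ℚ.+ ε ℚ.- x
  eq = solve-∀ ℚ-ring

≈-sym : ∀ {x y} → x ≈ y → y ≈ x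
≈-sym = swap

≈-trans : ∀ {x y z} → x ≈ y → y ≈ z → x ≈ z
≈-trans (x≤y , y≤x) (y≤z , z≤y) = ≤-trans x≤y y≤z , ≤-trans z≤y y≤x

<⇒≤ : ∀ {x y} → x < y → x ≤ y
<⇒≤ {x} {y} (mk< γ 0<γ x<y) .eventually≤ ε 0<ε = eventually-map
  (λ {n} p → ℚ.≤-trans (ℚ.≤-trans (p≤p+q (seq x n) (ℚ.<⇒≤ 0<γ)) p) (p≤p+q (seq y n) (ℚ.<⇒≤ 0<ε)))
  x<y

<-≤-trans : ∀ {x y z} → x < y → y ≤ z → x < z
<-≤-trans {x} {y} {z} (mk< γ 0<γ x<y) y≤z = mk< (½ ℚ.* γ) (half>0 0<γ)
  (eventually₂ {λ n → seq x n ℚ.+ γ ℚ.≤ seq y n} {λ n → seq y n ℚ.≤ seq z n ℚ.+ ½ ℚ.* γ}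
    (λ {n} p q → ≤-by (p ⊹ q) (eq (seq x n) (seq y n) (seq z n) γ))
    x<y (eventually≤ y≤z _ (half>0 0<γ)))
  where
  eq : ∀ x y z γ → y ℚ.+ (z ℚ.+ ½ ℚ.* γ) ℚ.- (x ℚ.+ γ ℚ.+ y) ≡ z ℚ.- (x ℚ.+ ½ ℚ.* γ)
  eq = solve-∀ ℚ-ring

<-irrefl : ∀ {x} → not x < x
<-irrefl {x} (mk< γ 0<γ (N , p)) =
  ℚ-<⇒≱ 0<γ (≤-by (p N ℕ.≤-refl) (eq (seq x N) γ))
  where
  eq : ∀ x γ → x ℚ.- (x ℚ.+ γ) ≡ 0ℚ ℚ.- γ
  eq = solve-∀ ℚ-ring

<⇒≱ : ∀ {x y} → x < y → not y ≤ x
<⇒≱ x<y y≤x = <-irrefl (<-≤-trans x<y y≤x)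

<-contradiction : ∀ {x y} {A : Set} → x < y → y < x → A
<-contradiction x<y y<x = contradiction (<⇒≤ y<x) (<⇒≱ x<y)

-- The constructive substitute for deciding the order: at an index where all three reals have
-- settled, the entry of `z` is compared with that of `x` plus half the gap.
<-cotrans : ∀ {x y} → x < y → ∀ z → x < z ⊎ z < y
<-cotrans {x} {y} (mk< γ 0<γ x<y) z = by-index
  (eventually⇒∃ (x<y & eventually-settled x 0<η & eventually-settled y 0<η & eventually-settled z 0<η))
  where
  -- An eighth of the gap: either outcome has `γ / 2` to spare, settling costs two `η`, and `γ / 4`
  -- is left as the new gap.
  η = ½ ℚ.* (½ ℚ.* (½ ℚ.* γ))
  0<η : 0ℚ ℚ.< η
  0<η = half>0 (half>0 (half>0 0<γ))
  below : ∀ xi zi x z γ → let η = ½ ℚ.* (½ ℚ.* (½ ℚ.* γ)) in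
          zi ℚ.+ (xi ℚ.+ η) ℚ.+ (z ℚ.+ η) ℚ.- (xi ℚ.+ ½ ℚ.* γ ℚ.+ x ℚ.+ zi) ≡ z ℚ.- (x ℚ.+ ½ ℚ.* (½ ℚ.* γ))
  below = solve-∀ ℚ-ring
  above : ∀ xi yi zi y z γ → let η = ½ ℚ.* (½ ℚ.* (½ ℚ.* γ)) in
          xi ℚ.+ ½ ℚ.* γ ℚ.+ yi ℚ.+ (y ℚ.+ η) ℚ.+ (zi ℚ.+ η) ℚ.- (zi ℚ.+ (xi ℚ.+ γ) ℚ.+ yi ℚ.+ z)
          ≡ y ℚ.- (z ℚ.+ ½ ℚ.* (½ ℚ.* γ))
  above = solve-∀ ℚ-ring
  by-index : ∃[ i ] (seq x i ℚ.+ γ ℚ.≤ seq y i × Settled x η i × Settled y η i × Settled z η i) →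
             x < z ⊎ z < y
  by-index (i , xi<yi , sx , sy , sz) with ℚ.≤-total (seq x i ℚ.+ ½ ℚ.* γ) (seq z i)
  ... | inj₁ xi≤zi = inj₁ (mk< _ (half>0 (half>0 0<γ)) (i , λ j i≤j →
    ≤-by (xi≤zi ⊹ proj₂ (sx j i≤j) ⊹ proj₁ (sz j i≤j)) (below (seq x i) (seq z i) (seq x j) (seq z j) γ)))
  ... | inj₂ zi≤xi = inj₂ (mk< _ (half>0 (half>0 0<γ)) (i , λ j i≤j →
    ≤-by (zi≤xi ⊹ xi<yi ⊹ proj₁ (sy j i≤j) ⊹ proj₂ (sz j i≤j))
      (above (seq x i) (seq y i) (seq z i) (seq y j) (seq z j) γ)))

x<x+ε : ∀ x {ε} → 0ℝ < ε → x < x + ε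
x<x+ε x {ε} (mk< γ 0<γ 0<ε) = mk< γ 0<γ (eventually-map (λ {n} p → ≤-by p (eq (seq x n) (seq ε n) γ)) 0<ε)
  where
  eq : ∀ x ε γ → ε ℚ.- (0ℚ ℚ.+ γ) ≡ x ℚ.+ ε ℚ.- (x ℚ.+ γ)
  eq = solve-∀ ℚ-ring

-- Cotransitivity applied to `x < x + ε` leaves only `y < x + ε`, for every `ε`. So weak
-- inequalities may be proved by contradiction, which is what lower bounds on covers and membership
-- in complements rely on.
≮⇒≥ : ∀ {x y} → not x < y → y ≤ x
≮⇒≥ {x} {y} x≮y = <+ε⇒≤ λ ε 0<ε → close ε (<-cotrans (x<x+ε x {ε} 0<ε) y)
  where
  close : ∀ ε → x < y ⊎ y < x + ε → y < x + ε
  close ε (inj₁ x<y) = contradiction x<y x≮y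
  close ε (inj₂ y<x+ε) = y<x+ε

≰⇒≥ : ∀ {x y} → not x ≤ y → y ≤ x
≰⇒≥ x≰y = ≮⇒≥ λ x<y → x≰y (<⇒≤ x<y)

+-mono-≤ : ∀ {x y z w} → x ≤ y → z ≤ w → x + z ≤ y + w
+-mono-≤ {x} {y} {z} {w} x≤y z≤w .eventually≤ ε 0<ε =
  eventually₂ {λ n → seq x n ℚ.≤ seq y n ℚ.+ ½ ℚ.* ε} {λ n → seq z n ℚ.≤ seq w n ℚ.+ ½ ℚ.* ε}
    (λ {n} p q → ≤-by (p ⊹ q) (eq (seq x n) (seq y n) (seq z n) (seq w n) ε))
    (eventually≤ x≤y _ (half>0 0<ε)) (eventually≤ z≤w _ (half>0 0<ε))
  where
  eq : ∀ x y z w ε → y ℚ.+ ½ ℚ.* ε ℚ.+ (w ℚ.+ ½ ℚ.* ε) ℚ.- (x ℚ.+ z) ≡ y ℚ.+ w ℚ.+ ε ℚ.- (x ℚ.+ z)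
  eq = solve-∀ ℚ-ring

≤-byℝ : ∀ {x y z w} → x ≤ y → (∀ n → seq y n ℚ.- seq x n ≡ seq w n ℚ.- seq z n) → z ≤ w
≤-byℝ x≤y eq = 0≤-⇒≤ (≤-trans (≤⇒0≤- x≤y) (pointwise-≤ λ n → ℚ.≤-reflexive (eq n)))

<-byℝ : ∀ {x y z w} → x < y → (∀ n → seq y n ℚ.- seq x n ≡ seq w n ℚ.- seq z n) → z < w
<-byℝ {x} {y} {z} {w} (mk< γ 0<γ x<y) eq = mk< γ 0<γ (eventually-map
  (λ {n} p → ≤-by p (trans (out (seq y n) (seq x n) γ)
     (trans (cong (ℚ._- γ) (eq n)) (sym (out (seq w n) (seq z n) γ))))) x<y)
  where
  out : ∀ y x γ → y ℚ.- (x ℚ.+ γ) ≡ y ℚ.- x ℚ.- γ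
  out = solve-∀ ℚ-ring

+-mono-≤-< : ∀ {x y z w} → x ≤ y → z < w → x + z < y + w
+-mono-≤-< {x} {y} {z} {w} x≤y (mk< γ 0<γ z<w) = mk< (½ ℚ.* γ) (half>0 0<γ) (eventually-map
  (λ {n} (p , q) → ≤-by (p ⊹ q) (eq (seq x n) (seq y n) (seq z n) (seq w n) γ))
  (eventually≤ x≤y _ (half>0 0<γ) & z<w))
  where
  eq : ∀ x y z w γ → y ℚ.+ ½ ℚ.* γ ℚ.+ w ℚ.- (x ℚ.+ (z ℚ.+ γ)) ≡ y ℚ.+ w ℚ.- (x ℚ.+ z ℚ.+ ½ ℚ.* γ)
  eq = solve-∀ ℚ-ring

x-δ<x : ∀ x {δ} → 0ℝ < δ → x - δ < x
x-δ<x x {δ} 0<δ = <-byℝ 0<δ λ n → eq (seq x n) (seq δ n)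
  where
  eq : ∀ x δ → δ ℚ.- 0ℚ ≡ x ℚ.- (x ℚ.- δ)
  eq = solve-∀ ℚ-ring

⊓-<-+ : ∀ {p q} r s ε → p ℚ.< r ℚ.+ ε → q ℚ.< s ℚ.+ ε → p ℚ.⊓ q ℚ.< r ℚ.⊓ s ℚ.+ ε
⊓-<-+ {p} {q} r s ε p<r+ε q<s+ε with ℚ.⊓-sel r s
... | inj₁ eq = subst (λ m → p ℚ.⊓ q ℚ.< m ℚ.+ ε) (sym eq) (ℚ.≤-<-trans (ℚ.p⊓q≤p p q) p<r+ε)
... | inj₂ eq = subst (λ m → p ℚ.⊓ q ℚ.< m ℚ.+ ε) (sym eq) (ℚ.≤-<-trans (ℚ.p⊓q≤q p q) q<s+ε)

abstract
  ⊓-cauchy : ∀ x y → IsCauchy (λ n → seq x n ℚ.⊓ seq y n)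
  ⊓-cauchy x y ε 0<ε
    with M , p ← cauchy x ε 0<ε
    with N , q ← cauchy y ε 0<ε = M ℕ.⊔ N , λ m n M⊔N≤m M⊔N≤n →
      let p′ : ∀ {i j} → M ℕ.⊔ N ℕ.≤ i → M ℕ.⊔ N ℕ.≤ j → seq x i ℚ.< seq x j ℚ.+ ε
          p′ i j = ∣p-q∣<r⇒p<q+r (p _ _ (ℕ.m⊔n≤o⇒m≤o M N i) (ℕ.m⊔n≤o⇒m≤o M N j))
          q′ : ∀ {i j} → M ℕ.⊔ N ℕ.≤ i → M ℕ.⊔ N ℕ.≤ j → seq y i ℚ.< seq y j ℚ.+ ε
          q′ i j = ∣p-q∣<r⇒p<q+r (q _ _ (ℕ.m⊔n≤o⇒n≤o M N i) (ℕ.m⊔n≤o⇒n≤o M N j))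
      in p<q+r⇒∣p-q∣<r
        (⊓-<-+ (seq x n) (seq y n) ε (p′ M⊔N≤m M⊔N≤n) (q′ M⊔N≤m M⊔N≤n))
        (⊓-<-+ (seq x m) (seq y m) ε (p′ M⊔N≤n M⊔N≤m) (q′ M⊔N≤n M⊔N≤m))

infixl 7 _⊓_

_⊓_ : ℝ → ℝ → ℝ
x ⊓ y = mkℝ (λ n → seq x n ℚ.⊓ seq y n) (⊓-cauchy x y)

x⊓y≤x : ∀ x y → x ⊓ y ≤ x
x⊓y≤x x y = pointwise-≤ λ n → ℚ.p⊓q≤p (seq x n) (seq y n)

x⊓y≤y : ∀ x y → x ⊓ y ≤ y
x⊓y≤y x y = pointwise-≤ λ n → ℚ.p⊓q≤q (seq x n) (seq y n)

⊓-glb : ∀ {x y z} → z ≤ x → z ≤ y → z ≤ x ⊓ y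
⊓-glb {x} {y} {z} z≤x z≤y .eventually≤ ε 0<ε =
  eventually₂ {λ n → seq z n ℚ.≤ seq x n ℚ.+ ε} {λ n → seq z n ℚ.≤ seq y n ℚ.+ ε}
    (λ {n} → glb (seq x n) (seq y n))
    (eventually≤ z≤x ε 0<ε) (eventually≤ z≤y ε 0<ε)
  where
  glb : ∀ p q {r} → r ℚ.≤ p ℚ.+ ε → r ℚ.≤ q ℚ.+ ε → r ℚ.≤ p ℚ.⊓ q ℚ.+ ε
  glb p q {r} r≤p r≤q with ℚ.⊓-sel p q
  ... | inj₁ eq = subst (λ m → r ℚ.≤ m ℚ.+ ε) (sym eq) r≤p
  ... | inj₂ eq = subst (λ m → r ℚ.≤ m ℚ.+ ε) (sym eq) r≤q

⊓-mono-≤ : ∀ {x y z w} → x ≤ y → z ≤ w → x ⊓ z ≤ y ⊓ w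
⊓-mono-≤ {x} {y} {z} {w} x≤y z≤w =
  ⊓-glb (≤-trans (x⊓y≤x x z) x≤y) (≤-trans (x⊓y≤y x z) z≤w)

-- A point outside a short cover

sum : (ℕ → ℚ) → ℕ → ℚ
sum f zero    = 0ℚ
sum f (suc n) = sum f n ℚ.+ f n

sum-+ : ∀ {f g h} → (∀ k → f k ℚ.+ g k ≡ h k) → ∀ n → sum f n ℚ.+ sum g n ≡ sum h n
sum-+ f+g≡h zero    = refl
sum-+ {f} {g} f+g≡h (suc n) = trans (eq (sum f n) (f n) (sum g n) (g n)) (cong₂ ℚ._+_ (sum-+ f+g≡h n) (f+g≡h n))
  where
  eq : ∀ a b c d → a ℚ.+ b ℚ.+ (c ℚ.+ d) ≡ a ℚ.+ c ℚ.+ (b ℚ.+ d)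
  eq = solve-∀ ℚ-ring

-- Compares the sums over the indices from `m` up to `n`, with the initial segments moved across. It
-- carries a bound on the tail of `g` over to `f`.
sum-tail-mono : ∀ {f g} → (∀ k → f k ℚ.≤ g k) → ∀ {m n} → m ℕ.≤′ n →
  sum f n ℚ.+ sum g m ℚ.≤ sum f m ℚ.+ sum g n
sum-tail-mono f≤g ℕ.≤′-refl = ℚ.≤-refl
sum-tail-mono {f} {g} f≤g {m} (ℕ.≤′-step {n} m≤n) =
  ≤-by (sum-tail-mono f≤g m≤n ⊹ f≤g n) (eq (sum f n) (f n) (sum g m) (sum f m) (sum g n) (g n))
  where
  eq : ∀ Fn f Gm Fm Gn g → Fm ℚ.+ Gn ℚ.+ g ℚ.- (Fn ℚ.+ Gm ℚ.+ f) ≡ Fm ℚ.+ (Gn ℚ.+ g) ℚ.- (Fn ℚ.+ f ℚ.+ Gm)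
  eq = solve-∀ ℚ-ring

sum-mono : ∀ {f g} → (∀ k → f k ℚ.≤ g k) → ∀ n → sum f n ℚ.≤ sum g n
sum-mono f≤g zero    = ℚ.≤-refl
sum-mono f≤g (suc n) = sum-mono f≤g n ⊹ f≤g n

sum≥0 : ∀ {f} → (∀ k → 0ℚ ℚ.≤ f k) → ∀ n → 0ℚ ℚ.≤ sum f n
sum≥0 0≤f zero    = ℚ.≤-refl
sum≥0 0≤f (suc n) = ℚ.≤-trans (sum≥0 0≤f n) (p≤p+q _ (0≤f n))

term≤sum : ∀ {f} → (∀ k → 0ℚ ℚ.≤ f k) → ∀ {k n} → suc k ℕ.≤′ n → f k ℚ.≤ sum f n
term≤sum {f} 0≤f {k} ℕ.≤′-refl =
  subst (ℚ._≤ sum f k ℚ.+ f k) (ℚ.+-identityˡ (f k)) (ℚ.+-monoˡ-≤ (f k) (sum≥0 0≤f k))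
term≤sum 0≤f (ℕ.≤′-step {n} k<n) = ℚ.≤-trans (term≤sum 0≤f k<n) (p≤p+q _ (0≤f n))

module Intervals
  (p q : ℕ → ℚ) (p≤q : ∀ k → p k ℚ.≤ q k)
  -- Convergence of the total size in Cauchy form: past `N`, further members add at most `δ`.
  (tail : ∀ δ → 0ℚ ℚ.< δ → ∃[ N ] ∀ m n → N ℕ.≤ m → m ℕ.≤ n →
          sum (λ k → q k ℚ.- p k) n ℚ.≤ sum (λ k → q k ℚ.- p k) m ℚ.+ δ)
  where

  size : ℕ → ℚ
  size k = q k ℚ.- p k

  clamp : ℕ → ℚ → ℚ
  clamp k x = p k ℚ.⊔ (q k ℚ.⊓ x)

  clamp-mono : ∀ k {x y} → x ℚ.≤ y → clamp k x ℚ.≤ clamp k y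
  clamp-mono k x≤y = ℚ.⊔-monoʳ-≤ (p k) (ℚ.⊓-monoʳ-≤ (q k) x≤y)

  p≤clamp : ∀ k x → p k ℚ.≤ clamp k x
  p≤clamp k x = ℚ.p≤p⊔q (p k) (q k ℚ.⊓ x)

  clamp≤q : ∀ k x → clamp k x ℚ.≤ q k
  clamp≤q k x = ℚ.⊔-lub (p≤q k) (ℚ.p⊓q≤p (q k) x)

  clamp-inside : ∀ k {x} → p k ℚ.≤ x → x ℚ.≤ q k → clamp k x ≡ x
  clamp-inside k {x} p≤x x≤q = trans (cong (p k ℚ.⊔_) (ℚ.p≥q⇒p⊓q≡q x≤q)) (ℚ.p≤q⇒p⊔q≡q p≤x)

  -- For u ≤ v, the length of [u , v] ∩ [p k , q k], written so as to be
  -- additive in [u , v].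
  meet : ℚ → ℚ → ℕ → ℚ
  meet u v k = clamp k v ℚ.- clamp k u

  meet≥0 : ∀ {u v} → u ℚ.≤ v → ∀ k → 0ℚ ℚ.≤ meet u v k
  meet≥0 u≤v k = p≤q⇒0≤q-p (clamp-mono k u≤v)

  meet≤size : ∀ u v k → meet u v k ℚ.≤ size k
  meet≤size u v k = clamp≤q k v ⊹ ℚ.neg-antimono-≤ (p≤clamp k u)

  meet-+ : ∀ u c v k → meet u c k ℚ.+ meet c v k ≡ meet u v k
  meet-+ u c v k = eq (clamp k u) (clamp k c) (clamp k v)
    where
    eq : ∀ a b c → (b ℚ.- a) ℚ.+ (c ℚ.- b) ≡ c ℚ.- a
    eq = solve-∀ ℚ-ring

  meet-disjoint : ∀ {v u′} u v′ → v ℚ.≤ u′ → ∀ k → meet u v k ℚ.+ meet u′ v′ k ℚ.≤ size k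
  meet-disjoint {v} {u′} u v′ v≤u′ k =
    ≤-by (clamp-mono k v≤u′ ⊹ meet≤size u v′ k)
      (eq (clamp k u) (clamp k v) (clamp k u′) (clamp k v′) (size k))
    where
    eq : ∀ a b c d s → c ℚ.+ s ℚ.- (b ℚ.+ (d ℚ.- a)) ≡ s ℚ.- (b ℚ.- a ℚ.+ (d ℚ.- c))
    eq = solve-∀ ℚ-ring

  -- The slack `δ` does not depend on `n`, so the members leave room in the interval even in the
  -- limit, and not merely at each finite stage.
  Thin : ℚ → ℚ → Set
  Thin u v = ∃[ δ ] 0ℚ ℚ.< δ × Eventually λ n → sum (meet u v) n ℚ.+ δ ℚ.≤ v ℚ.- u

  -- At a single stage `m`, a comparison of rationals tells whether the first interval has slack
  -- `δ / 2`; if not, the joint slack `δ` forces the second one to have it. The bound on the tail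
  -- extends the answer from stage `m` to all later ones.
  thin-one-of : ∀ {u v u′ v′ δ} → 0ℚ ℚ.< δ →
    Eventually (λ n → sum (meet u v) n ℚ.+ sum (meet u′ v′) n ℚ.+ δ ℚ.≤ (v ℚ.- u) ℚ.+ (v′ ℚ.- u′)) →
    Thin u v ⊎ Thin u′ v′
  thin-one-of {u} {v} {u′} {v′} {δ} 0<δ (M , both) = decide (ℚ.≤-total (sum (meet u v) m ℚ.+ ½ ℚ.* δ) (v ℚ.- u))
    where
    -- Of the slack `δ / 2` at stage `m`, the growth after `m` consumes at most `η`, and `η`
    -- remains.
    η = ½ ℚ.* (½ ℚ.* δ)
    0<η : 0ℚ ℚ.< η
    0<η = half>0 (half>0 0<δ)
    N = proj₁ (tail η 0<η)
    m = M ℕ.⊔ N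
    grow : ∀ u v n → m ℕ.≤ n → sum (meet u v) n ℚ.≤ sum (meet u v) m ℚ.+ η
    grow u v n m≤n = ≤-by
      (sum-tail-mono (meet≤size u v) (ℕ.≤⇒≤′ m≤n) ⊹ proj₂ (tail η 0<η) m n (ℕ.m≤n⊔m M N) m≤n)
      (eq (sum (meet u v) m) (sum (meet u v) n) (sum size m) (sum size n) η)
      where
      eq : ∀ om on sm sn η → om ℚ.+ sn ℚ.+ (sm ℚ.+ η) ℚ.- (on ℚ.+ sm ℚ.+ sn) ≡ om ℚ.+ η ℚ.- on
      eq = solve-∀ ℚ-ring
    thin : ∀ {u v} → sum (meet u v) m ℚ.+ ½ ℚ.* δ ℚ.≤ v ℚ.- u → Thin u v
    thin {u} {v} small = η , 0<η , m , λ n m≤n →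
      ≤-by (small ⊹ grow u v n m≤n) (eq (sum (meet u v) m) (sum (meet u v) n) (v ℚ.- u) δ)
      where
      eq : ∀ om on l δ → let η = ½ ℚ.* (½ ℚ.* δ) in
           l ℚ.+ (om ℚ.+ η) ℚ.- (om ℚ.+ ½ ℚ.* δ ℚ.+ on) ≡ l ℚ.- (on ℚ.+ η)
      eq = solve-∀ ℚ-ring
    decide : _ → Thin u v ⊎ Thin u′ v′
    decide (inj₁ small) = inj₁ (thin small)
    decide (inj₂ large) = inj₂ (thin (≤-by (large ⊹ both m (ℕ.m≤m⊔n M N))
      (eq (sum (meet u v) m) (sum (meet u′ v′) m) (v ℚ.- u) (v′ ℚ.- u′) δ)))
      where
      eq : ∀ o o′ l l′ δ → o ℚ.+ ½ ℚ.* δ ℚ.+ (l ℚ.+ l′) ℚ.- (l ℚ.+ (o ℚ.+ o′ ℚ.+ δ)) ≡ l′ ℚ.- (o′ ℚ.+ ½ ℚ.* δ)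
      eq = solve-∀ ℚ-ring

  -- A member containing `[u , v]` already meets it in its full length, so no slack is left.
  inside⇒¬thin : ∀ k {u v} → p k ℚ.≤ u → u ℚ.≤ v → v ℚ.≤ q k → not Thin u v
  inside⇒¬thin k {u} {v} p≤u u≤v v≤q (δ , 0<δ , N , small) =
    ℚ-<⇒≱ 0<δ (≤-by (small n (ℕ.m≤m⊔n N (suc k)) ⊹ full) (eq (sum (meet u v) n) (v ℚ.- u) δ))
    where
    -- `sum` ranges over the indices below `n`, so `n` must exceed `k` for the term at `k` to be
    -- counted.
    n = N ℕ.⊔ suc k
    full : v ℚ.- u ℚ.≤ sum (meet u v) n
    full = subst (ℚ._≤ sum (meet u v) n)
      (cong₂ ℚ._-_ (clamp-inside k (ℚ.≤-trans p≤u u≤v) v≤q) (clamp-inside k p≤u (ℚ.≤-trans u≤v v≤q)))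
      (term≤sum (meet≥0 u≤v) (ℕ.≤⇒≤′ (ℕ.m≤n⊔m N (suc k))))
    eq : ∀ o l δ → l ℚ.+ o ℚ.- (o ℚ.+ δ ℚ.+ l) ≡ 0ℚ ℚ.- δ
    eq = solve-∀ ℚ-ring

  record ThinInterval : Set where
    field
      left right : ℚ
      left≤right : left ℚ.≤ right
      thin       : Thin left right

    width : ℚ
    width = right ℚ.- left

  open ThinInterval

  record Half (I : ThinInterval) : Set where
    field
      half        : ThinInterval
      left≤left   : left I ℚ.≤ left half
      right≤right : right half ℚ.≤ right I
      half-width  : width half ≡ ½ ℚ.* width I

  open Half

  -- By `meet-+` the slack of `I` is the joint slack of the two halves, and `thin-one-of` finds a
  -- half that inherits some of it.
  halve : ∀ I → Half I
  halve I with δ , 0<δ , N , small ← thin I =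
    pick (thin-one-of 0<δ (N , λ n N≤n → subst₂ ℚ._≤_
      (cong (ℚ._+ δ) (sym (sum-+ (meet-+ u c v) n))) (eq₀ u v) (small n N≤n)))
    where
    u = left I
    v = right I
    c = ½ ℚ.* (u ℚ.+ v)
    eq₀ : ∀ u v → let c = ½ ℚ.* (u ℚ.+ v) in v ℚ.- u ≡ (c ℚ.- u) ℚ.+ (v ℚ.- c)
    eq₀ = solve-∀ ℚ-ring
    0≤w : ½ ℚ.* u ℚ.≤ ½ ℚ.* v
    0≤w = ℚ.*-monoˡ-≤-nonNeg ½ (left≤right I)
    u≤c : u ℚ.≤ c
    u≤c = ≤-by 0≤w (eq u v)
      where
      eq : ∀ u v → ½ ℚ.* v ℚ.- ½ ℚ.* u ≡ ½ ℚ.* (u ℚ.+ v) ℚ.- u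
      eq = solve-∀ ℚ-ring
    c≤v : c ℚ.≤ v
    c≤v = ≤-by 0≤w (eq u v)
      where
      eq : ∀ u v → ½ ℚ.* v ℚ.- ½ ℚ.* u ≡ v ℚ.- ½ ℚ.* (u ℚ.+ v)
      eq = solve-∀ ℚ-ring
    pick : Thin u c ⊎ Thin c v → Half I
    pick (inj₁ t) = record
      { half = record { left = u ; right = c ; left≤right = u≤c ; thin = t }
      ; left≤left = ℚ.≤-refl ; right≤right = c≤v ; half-width = eq u v }
      where
      eq : ∀ u v → ½ ℚ.* (u ℚ.+ v) ℚ.- u ≡ ½ ℚ.* (v ℚ.- u)
      eq = solve-∀ ℚ-ring
    pick (inj₂ t) = record
      { half = record { left = c ; right = v ; left≤right = c≤v ; thin = t }
      ; left≤left = u≤c ; right≤right = ℚ.≤-refl ; half-width = eq u v }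
      where
      eq : ∀ u v → v ℚ.- ½ ℚ.* (u ℚ.+ v) ≡ ½ ℚ.* (v ℚ.- u)
      eq = solve-∀ ℚ-ring

  -- Rational addition unfolds on open terms: the iterated halves have to be sealed.
  abstract
    bisect : ∀ I → Half I
    bisect = halve

  module _ (I : ThinInterval) where

    nested : ℕ → ThinInterval
    nested zero    = I
    nested (suc n) = half (bisect (nested n))

    nested-left : ∀ {m n} → m ℕ.≤′ n → left (nested m) ℚ.≤ left (nested n)
    nested-left ℕ.≤′-refl       = ℚ.≤-refl
    nested-left (ℕ.≤′-step {n} m≤n) = ℚ.≤-trans (nested-left m≤n) (left≤left (bisect (nested n)))

    nested-right : ∀ {m n} → m ℕ.≤′ n → right (nested n) ℚ.≤ right (nested m)
    nested-right ℕ.≤′-refl       = ℚ.≤-refl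
    nested-right (ℕ.≤′-step {n} m≤n) = ℚ.≤-trans (right≤right (bisect (nested n))) (nested-right m≤n)

    nested-width : ∀ n → width (nested n) ≡ halvings (width I) n
    nested-width zero    = refl
    nested-width (suc n) = trans (half-width (bisect (nested n))) (cong (½ ℚ.*_) (nested-width n))

    nested-width→0 : ∀ {ε} → 0ℚ ℚ.< ε → ∃[ n ] right (nested n) ℚ.≤ left (nested n) ℚ.+ ε
    nested-width→0 {ε} 0<ε = narrow (eventually⇒∃ (halvings→0 (p≤q⇒0≤q-p (left≤right I)) 0<ε))
      where
      eq : ∀ l r ε → ε ℚ.- (r ℚ.- l) ≡ l ℚ.+ ε ℚ.- r
      eq = solve-∀ ℚ-ring
      narrow : ∃[ n ] halvings (width I) n ℚ.≤ ε → ∃[ n ] right (nested n) ℚ.≤ left (nested n) ℚ.+ ε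
      narrow (n , small) = n ,
        ≤-by (ℚ.≤-trans (ℚ.≤-reflexive (nested-width n)) small) (eq (left (nested n)) (right (nested n)) ε)

    left≤right-nested : ∀ {m n} → m ℕ.≤ n → left (nested n) ℚ.≤ right (nested m)
    left≤right-nested {n = n} m≤n = ℚ.≤-trans (left≤right (nested n)) (nested-right (ℕ.≤⇒≤′ m≤n))

    limit-cauchy : IsCauchy (λ n → left (nested n))
    limit-cauchy ε 0<ε = N , λ m n N≤m N≤n → p<q+r⇒∣p-q∣<r (close N≤m N≤n) (close N≤n N≤m)
      where
      narrow = nested-width→0 (half>0 0<ε)
      N = proj₁ narrow
      ½ε<ε : ½ ℚ.* ε ℚ.< ε
      ½ε<ε = subst₂ ℚ._<_ (ℚ.+-identityʳ (½ ℚ.* ε)) (half+half ε) (ℚ.+-monoʳ-< (½ ℚ.* ε) (half>0 0<ε))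
      close : ∀ {m n} → N ℕ.≤ m → N ℕ.≤ n → left (nested m) ℚ.< left (nested n) ℚ.+ ε
      close N≤m N≤n = ℚ.≤-<-trans (left≤right-nested N≤m) (ℚ.≤-<-trans (proj₂ narrow)
        (ℚ.+-mono-≤-< (nested-left (ℕ.≤⇒≤′ N≤n)) ½ε<ε))

    abstract
      limit : ℝ
      limit = mkℝ (λ n → left (nested n)) limit-cauchy

      left≤limit : ∀ {m n} → m ℕ.≤ n → left (nested m) ℚ.≤ seq limit n
      left≤limit m≤n = nested-left (ℕ.≤⇒≤′ m≤n)

      limit≤right : ∀ {m n} → m ℕ.≤ n → seq limit n ℚ.≤ right (nested m)
      limit≤right = left≤right-nested

    -- If the limit were strictly inside member `k`, a nested interval narrower than both gaps would
    -- lie within that member, yet every nested interval is thin.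
    limit-uncovered : ∀ k → fromℚ (p k) < limit → not limit < fromℚ (q k)
    limit-uncovered k (mk< γ₁ 0<γ₁ (M₁ , p<x)) (mk< γ₂ 0<γ₂ (M₂ , x<q)) =
      inside⇒¬thin k p≤u (left≤right (nested j)) v≤q (thin (nested j))
      where
      γ = γ₁ ℚ.⊓ γ₂
      narrow = nested-width→0 (⊓>0 γ₁ γ₂ 0<γ₁ 0<γ₂)
      j = proj₁ narrow
      u = left (nested j)
      v = right (nested j)
      i = M₁ ℕ.⊔ M₂ ℕ.⊔ j
      M≤i : M₁ ℕ.⊔ M₂ ℕ.≤ i
      M≤i = ℕ.m≤m⊔n (M₁ ℕ.⊔ M₂) j
      j≤i : j ℕ.≤ i
      j≤i = ℕ.m≤n⊔m (M₁ ℕ.⊔ M₂) j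
      p≤u : p k ℚ.≤ u
      p≤u = ≤-by (p<x i (ℕ.m⊔n≤o⇒m≤o M₁ M₂ M≤i) ⊹ limit≤right j≤i ⊹ proj₂ narrow ⊹ ℚ.p⊓q≤p γ₁ γ₂)
        (eq (p k) (seq limit i) u v γ₁ γ)
        where
        eq : ∀ p x u v γ₁ γ → x ℚ.+ v ℚ.+ (u ℚ.+ γ) ℚ.+ γ₁ ℚ.- (p ℚ.+ γ₁ ℚ.+ x ℚ.+ v ℚ.+ γ) ≡ u ℚ.- p
        eq = solve-∀ ℚ-ring
      v≤q : v ℚ.≤ q k
      v≤q = ≤-by (x<q i (ℕ.m⊔n≤o⇒n≤o M₁ M₂ M≤i) ⊹ left≤limit j≤i ⊹ proj₂ narrow ⊹ ℚ.p⊓q≤q γ₁ γ₂)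
        (eq (q k) (seq limit i) u v γ₂ γ)
        where
        eq : ∀ q x u v γ₂ γ → q ℚ.+ x ℚ.+ (u ℚ.+ γ) ℚ.+ γ₂ ℚ.- (x ℚ.+ γ₂ ℚ.+ u ℚ.+ v ℚ.+ γ) ≡ q ℚ.- v
        eq = solve-∀ ℚ-ring

-- Covers by rational intervals

record Enclosure (l h : ℝ) (e : ℚ) : Set where
  field
    p q   : ℚ
    p≤q   : p ℚ.≤ q
    p≤l   : fromℚ p ≤ l
    h≤q   : h ≤ fromℚ q
    size≤ : Eventually λ i → q ℚ.- p ℚ.≤ seq h i ℚ.- seq l i ℚ.+ e

abstract
  enclose : ∀ {l h e} → l ≤ h → 0ℚ ℚ.< e → Enclosure l h e
  enclose {l} {h} {e} l≤h 0<e =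
    at (eventually⇒∃ (eventually≤ l≤h η 0<η & eventually-settled l 0<η & eventually-settled h 0<η))
    where
    η : ℚ
    -- Both ends are moved outwards by `η`, and each settled entry is off by at most another `η`:
    -- four in all make `e`.
    η = ½ ℚ.* (½ ℚ.* e)
    0<η : 0ℚ ℚ.< η
    0<η = half>0 (half>0 0<e)
    eq₁ : ∀ l h η → h ℚ.+ η ℚ.+ η ℚ.- (l ℚ.+ 0ℚ) ≡ h ℚ.+ η ℚ.- (l ℚ.- η)
    eq₁ = solve-∀ ℚ-ring
    eq₂ : ∀ li l η → l ℚ.+ η ℚ.- li ≡ l ℚ.- (li ℚ.- η)
    eq₂ = solve-∀ ℚ-ring
    eq₃ : ∀ li hi l h e → let η = ½ ℚ.* (½ ℚ.* e) in
          li ℚ.+ η ℚ.+ (h ℚ.+ η) ℚ.- (l ℚ.+ hi) ≡ h ℚ.- l ℚ.+ e ℚ.- (hi ℚ.+ η ℚ.- (li ℚ.- η))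
    eq₃ = solve-∀ ℚ-ring
    at : ∃[ i ] (seq l i ℚ.≤ seq h i ℚ.+ η × Settled l η i × Settled h η i) → Enclosure l h e
    at (i , li≤hi , sl , sh) = record
      { p        = seq l i ℚ.- η
      ; q        = seq h i ℚ.+ η
      ; p≤q      = ≤-by (li≤hi ⊹ ℚ.<⇒≤ 0<η) (eq₁ (seq l i) (seq h i) η)
      ; p≤l      = eventually-≤ (i , λ j i≤j → ≤-by (proj₁ (sl j i≤j)) (eq₂ (seq l i) (seq l j) η))
      ; h≤q      = eventually-≤ (i , λ j i≤j → proj₂ (sh j i≤j))
      ; size≤    = i , λ j i≤j → ≤-by (proj₂ (sl j i≤j) ⊹ proj₁ (sh j i≤j))
                                   (eq₃ (seq l i) (seq h i) (seq l j) (seq h j) e)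
      }

module Rationalised {X : Pred ℝ 0ℓ} (C : Cover X) {s : ℝ} (hasSum : HasSum (Cover.len C) s)
                    {κ : ℚ} (0<κ : 0ℚ ℚ.< κ) where

  open Cover C

  enclosure : ∀ k → Enclosure (lo k) (hi k) (halvings κ (suc k))
  enclosure k = enclose (lo≤hi k) (halvings>0 0<κ (suc k))

  open module E k = Enclosure (enclosure k) public

  size : ℕ → ℚ
  size k = q k ℚ.- p k

  -- The errors κ/2, κ/4, … telescope: those from index m on sum up to halvings κ m.
  sizes≤lengths : ∀ {m n} → m ℕ.≤′ n → Eventually λ i →
    sum size n ℚ.+ seq (partialSum len m) i ℚ.+ halvings κ n ℚ.≤
    sum size m ℚ.+ seq (partialSum len n) i ℚ.+ halvings κ m
  sizes≤lengths ℕ.≤′-refl = always λ _ → ℚ.≤-refl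
  sizes≤lengths {m} (ℕ.≤′-step {n} m≤n) = eventually-map
    (λ {i} (ih , step) → ≤-by (ih ⊹ step)
      (eq (sum size n) (sum size m) (seq (partialSum len n) i) (seq (partialSum len m) i)
          (halvings κ n) (halvings κ m) (size n) (seq (len n) i)))
    (sizes≤lengths m≤n & size≤ n)
    where
    eq : ∀ sn sm ln lm hn hm z l →
         sm ℚ.+ ln ℚ.+ hm ℚ.+ (l ℚ.+ ½ ℚ.* hn) ℚ.- (sn ℚ.+ lm ℚ.+ hn ℚ.+ z) ≡
         sm ℚ.+ (ln ℚ.+ l) ℚ.+ hm ℚ.- (sn ℚ.+ z ℚ.+ lm ℚ.+ ½ ℚ.* hn)
    eq = solve-∀ ℚ-ring

  partialSum< : ∀ {δ} → 0ℚ ℚ.< δ → Eventually λ n →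
    Eventually (λ i → seq (partialSum len n) i ℚ.≤ seq s i ℚ.+ δ) ×
    Eventually (λ i → seq s i ℚ.≤ seq (partialSum len n) i ℚ.+ δ)
  partialSum< {δ} 0<δ = eventually-map (λ (l<s , s<l) → drop l<s , drop s<l) (hasSum (fromℚ δ) (fromℚ>0 0<δ))
    where
    drop : ∀ {x y} → x < y → Eventually (λ i → seq x i ℚ.≤ seq y i)
    drop {x} (mk< γ 0<γ x<y) = eventually-map (λ {i} → ℚ.≤-trans (p≤p+q (seq x i) (ℚ.<⇒≤ 0<γ))) x<y

  -- Past `N`, the partial sums of the lengths at `m` and `n` are each within `η` of `s`, and the
  -- enclosure errors from `m` on add at most `halvings κ m ≤ η`.
  sizes-tail : ∀ δ → 0ℚ ℚ.< δ → ∃[ N ] ∀ m n → N ℕ.≤ m → m ℕ.≤ n → sum size n ℚ.≤ sum size m ℚ.+ δ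
  sizes-tail δ 0<δ = from (partialSum< 0<η & halvings→0 (ℚ.<⇒≤ 0<κ) 0<η)
    where
    η : ℚ
    η = ½ ℚ.* (½ ℚ.* δ)
    0<η : 0ℚ ℚ.< η
    0<η = half>0 (half>0 0<δ)
    eq : ∀ sn sm ln lm hn hm s δ → let η = ½ ℚ.* (½ ℚ.* δ) in
      sm ℚ.+ ln ℚ.+ hm ℚ.+ (s ℚ.+ η) ℚ.+ (lm ℚ.+ η) ℚ.+ η ℚ.+ hn ℚ.+ η ℚ.-
      (sn ℚ.+ lm ℚ.+ hn ℚ.+ ln ℚ.+ s ℚ.+ hm ℚ.+ 0ℚ ℚ.+ 0ℚ) ≡
      sm ℚ.+ δ ℚ.- sn
    eq = solve-∀ ℚ-ring
    from : Eventually _ → ∃[ N ] ∀ m n → N ℕ.≤ m → m ℕ.≤ n → sum size n ℚ.≤ sum size m ℚ.+ δ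
    from (N , close) = N , λ m n N≤m m≤n →
      let (_ , s≤lm) , hm≤η = close m N≤m
          (ln≤s , _) , _    = close n (ℕ.≤-trans N≤m m≤n)
          i , grow , upper , lower = eventually⇒∃ (sizes≤lengths {m} {n} (ℕ.≤⇒≤′ m≤n) & ln≤s & s≤lm)
      in ≤-by (grow ⊹ upper ⊹ lower ⊹ hm≤η ⊹ halvings≥0 (ℚ.<⇒≤ 0<κ) n ⊹ ℚ.<⇒≤ 0<η)
           (eq (sum size n) (sum size m) (seq (partialSum len n) i) (seq (partialSum len m) i)
               (halvings κ n) (halvings κ m) (seq s i) δ)

  -- One `κ` pays for all enclosure errors, the other for the distance from the partial sum of the
  -- lengths to `s`. The threshold for `i` may depend on `n`, hence the nesting.
  sizes≤s+2κ : Eventually λ n → Eventually λ i → sum size n ℚ.≤ seq s i ℚ.+ (κ ℚ.+ κ)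
  sizes≤s+2κ = eventually-map
    (λ {n} (ln≤s , _) → eventually-map
      (λ {i} (grow , upper) → ≤-by (grow ⊹ upper ⊹ halvings≥0 (ℚ.<⇒≤ 0<κ) n)
        (eq (sum size n) (seq (partialSum len n) i) (halvings κ n) (seq s i) κ))
      (sizes≤lengths {0} {n} (ℕ.≤⇒≤′ ℕ.z≤n) & ln≤s))
    (partialSum< 0<κ)
    where
    eq : ∀ sn ln hn s κ →
      0ℚ ℚ.+ ln ℚ.+ κ ℚ.+ (s ℚ.+ κ) ℚ.+ hn ℚ.- (sn ℚ.+ 0ℚ ℚ.+ hn ℚ.+ ln ℚ.+ 0ℚ) ≡ s ℚ.+ (κ ℚ.+ κ) ℚ.- sn
    eq = solve-∀ ℚ-ring

  open Intervals p q p≤q sizes-tail public hiding (size)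

  thin⇒∉ : (I : ThinInterval) → not X (limit I)
  thin⇒∉ I x∈X = from (covers x∈X)
    where
    from : not (∃[ k ] (lo k < limit I × limit I < hi k))
    from (k , lo<x , x<hi) = limit-uncovered I k (≤-<-trans (p≤l k) lo<x) (<-≤-trans x<hi (h≤q k))

  long⇒thin : ∀ {u v δ} → 0ℚ ℚ.< δ → Eventually (λ n → sum size n ℚ.+ δ ℚ.≤ v ℚ.- u) → Thin u v
  long⇒thin {u} {v} {δ} 0<δ long = δ , 0<δ , eventually-map
    (λ {n} → ℚ.≤-trans (ℚ.+-monoˡ-≤ δ (sum-mono (meet≤size u v) n))) long

  long⇒≤ : ∀ {u v δ} → 0ℚ ℚ.< δ → Eventually (λ n → sum size n ℚ.+ δ ℚ.≤ v ℚ.- u) → u ℚ.≤ v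
  long⇒≤ {u} {v} {δ} 0<δ (N , long) =
    ≤-by (long N ℕ.≤-refl ⊹ sum≥0 (λ k → p≤q⇒0≤q-p (p≤q k)) N ⊹ ℚ.<⇒≤ 0<δ)
    (eq (sum size N) δ u v)
    where
    eq : ∀ s δ u v → v ℚ.- u ℚ.+ s ℚ.+ δ ℚ.- (s ℚ.+ δ ℚ.+ 0ℚ ℚ.+ 0ℚ) ≡ v ℚ.- u
    eq = solve-∀ ℚ-ring

  -- A degenerate interval (v ≤ u) is dropped first, thin intervals being
  -- required to be nonempty.
  thin-interval : ∀ {u v u′ v′ δ} → 0ℚ ℚ.< δ → v ℚ.≤ u′ →
    Eventually (λ n → sum size n ℚ.+ δ ℚ.≤ (v ℚ.- u) ℚ.+ (v′ ℚ.- u′)) →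
    ∃[ I ] (ThinInterval.left I ≡ u × ThinInterval.right I ≡ v ⊎
          ThinInterval.left I ≡ u′ × ThinInterval.right I ≡ v′)
  thin-interval {u} {v} {u′} {v′} {δ} 0<δ v≤u′ long = choose (ℚ.≤-total u v) (ℚ.≤-total u′ v′)
    where
    first : u ℚ.≤ v → Thin u v → ∃[ I ] _
    first u≤v t = record { left≤right = u≤v ; thin = t } , inj₁ (refl , refl)
    second : u′ ℚ.≤ v′ → Thin u′ v′ → ∃[ I ] _
    second u≤v t = record { left≤right = u≤v ; thin = t } , inj₂ (refl , refl)
    choose : u ℚ.≤ v ⊎ v ℚ.≤ u → u′ ℚ.≤ v′ ⊎ v′ ℚ.≤ u′ → ∃[ I ] _
    choose (inj₂ v≤u) _ = second (long⇒≤ 0<δ long′) (long⇒thin 0<δ long′)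
      where
      eq : ∀ s u v l → (v ℚ.- u) ℚ.+ l ℚ.+ u ℚ.- (s ℚ.+ v) ≡ l ℚ.- s
      eq = solve-∀ ℚ-ring
      long′ = eventually-map (λ {n} l → ≤-by (l ⊹ v≤u) (eq (sum size n ℚ.+ δ) u v (v′ ℚ.- u′))) long
    choose (inj₁ _) (inj₂ v′≤u′) = first (long⇒≤ 0<δ long′) (long⇒thin 0<δ long′)
      where
      eq : ∀ s u v l → l ℚ.+ (v ℚ.- u) ℚ.+ u ℚ.- (s ℚ.+ v) ≡ l ℚ.- s
      eq = solve-∀ ℚ-ring
      long′ = eventually-map (λ {n} l → ≤-by (l ⊹ v′≤u′) (eq (sum size n ℚ.+ δ) u′ v′ (v ℚ.- u))) long
    choose (inj₁ u≤v) (inj₁ u′≤v′) = from (thin-one-of 0<δ (eventually-map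
      (λ {n} → ℚ.≤-trans (ℚ.+-monoˡ-≤ δ (subst (ℚ._≤ sum size n)
         (sym (sum-+ {meet u v} {meet u′ v′} (λ _ → refl) n))
         (sum-mono (meet-disjoint u v′ v≤u′) n)))) long))
      where
      from : Thin u v ⊎ Thin u′ v′ → ∃[ I ] _
      from (inj₁ t) = first u≤v t
      from (inj₂ t) = second u′≤v′ t

-- If the cover were too short, slightly shrunken rational copies of the two intervals would still
-- exceed the rationalised cover. One of them is then thin, and the limit of its bisection is a
-- point of `X` that the cover misses. Treating two intervals at once handles `a ⁰ ∪ b ¹`; a single
-- interval is the case where the other is degenerate.
coverLength≥ : ∀ {X s u v u′ v′} → CoverLength X s → v ≤ u′ →
  (∀ {x} → u < x → x < v → X x) → (∀ {x} → u′ < x → x < v′ → X x) →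
  (v - u) + (v′ - u′) ≤ s
coverLength≥ {X} {s} {u} {v} {u′} {v′} (C , hasSum) v≤u′ ⊆X ⊆X′ = ≮⇒≥ not-shorter
  where
  not-shorter : not s < (v - u) + (v′ - u′)
  not-shorter (mk< γ 0<γ short) = at (eventually⇒∃
    (short & eventually≤ v≤u′ η 0<η & eventually-settled s 0<η & eventually-settled u 0<η
     & eventually-settled v 0<η & eventually-settled u′ 0<η & eventually-settled v′ 0<η))
    where
    η : ℚ
    -- `γ` is sixteen `η`. Shrinking four ends costs eight, the rationalised cover two, settling `s`
    -- one; of the remaining five, four form the slack `γ / 4`.
    η = halvings γ 4
    0<η : 0ℚ ℚ.< η
    0<η = halvings>0 0<γ 4
    open Rationalised C hasSum 0<η
    at : not (∃[ i ] (seq s i ℚ.+ γ ℚ.≤ seq v i ℚ.- seq u i ℚ.+ (seq v′ i ℚ.- seq u′ i) ×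
                   seq v i ℚ.≤ seq u′ i ℚ.+ η ×
                   Settled s η i × Settled u η i × Settled v η i × Settled u′ η i × Settled v′ η i))
    at (i , short , v≤u′ , ss , su , sv , su′ , sv′) = refute (thin-interval (half>0 (half>0 0<γ)) V≤U′ long)
      where
      -- Each end moves inwards by two `η`: one absorbs the settling error, the other makes the
      -- limit point lie strictly between the real endpoints.
      U V U′ V′ : ℚ
      U  = seq u i ℚ.+ (η ℚ.+ η)
      V  = seq v i ℚ.- (η ℚ.+ η)
      U′ = seq u′ i ℚ.+ (η ℚ.+ η)
      V′ = seq v′ i ℚ.- (η ℚ.+ η)
      V≤U′ : V ℚ.≤ U′
      V≤U′ = ≤-by (v≤u′ ⊹ ℚ.<⇒≤ 0<η ⊹ ℚ.<⇒≤ 0<η ⊹ ℚ.<⇒≤ 0<η) (eq (seq v i) (seq u′ i) η)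
        where
        eq : ∀ v u η → u ℚ.+ η ℚ.+ η ℚ.+ η ℚ.+ η ℚ.- (v ℚ.+ 0ℚ ℚ.+ 0ℚ ℚ.+ 0ℚ) ≡
                       u ℚ.+ (η ℚ.+ η) ℚ.- (v ℚ.- (η ℚ.+ η))
        eq = solve-∀ ℚ-ring
      long : Eventually λ n → sum size n ℚ.+ ½ ℚ.* (½ ℚ.* γ) ℚ.≤ (V ℚ.- U) ℚ.+ (V′ ℚ.- U′)
      long = eventually-map (λ {n} → bound {n}) sizes≤s+2κ
        where
        eq : ∀ S sj si u v u′ v′ γ → let η = ½ ℚ.* (½ ℚ.* (½ ℚ.* (½ ℚ.* γ))) in
          sj ℚ.+ (η ℚ.+ η) ℚ.+ (si ℚ.+ η) ℚ.+ ((v ℚ.- u) ℚ.+ (v′ ℚ.- u′)) ℚ.+ η ℚ.-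
            (S ℚ.+ sj ℚ.+ (si ℚ.+ γ) ℚ.+ 0ℚ) ≡
          (v ℚ.- (η ℚ.+ η) ℚ.- (u ℚ.+ (η ℚ.+ η))) ℚ.+ (v′ ℚ.- (η ℚ.+ η) ℚ.- (u′ ℚ.+ (η ℚ.+ η))) ℚ.-
            (S ℚ.+ ½ ℚ.* (½ ℚ.* γ))
        eq = solve-∀ ℚ-ring
        bound : ∀ {n} → Eventually (λ j → sum size n ℚ.≤ seq s j ℚ.+ (η ℚ.+ η)) →
                sum size n ℚ.+ ½ ℚ.* (½ ℚ.* γ) ℚ.≤ (V ℚ.- U) ℚ.+ (V′ ℚ.- U′)
        bound {n} (N , S≤s) = ≤-by
          (S≤s (N ℕ.⊔ i) (ℕ.m≤m⊔n N i) ⊹ proj₂ (ss (N ℕ.⊔ i) (ℕ.m≤n⊔m N i)) ⊹ short ⊹ ℚ.<⇒≤ 0<η)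
          (eq (sum size n) (seq s (N ℕ.⊔ i)) (seq s i) (seq u i) (seq v i) (seq u′ i) (seq v′ i) γ)
      above : ∀ {u} I → Settled u η i → ThinInterval.left I ≡ seq u i ℚ.+ (η ℚ.+ η) → u < limit I
      above {u} I su refl = mk< η 0<η (i , λ j i≤j → ≤-by
        (proj₂ (su j i≤j) ⊹ left≤limit I ℕ.z≤n)
        (eq (seq u i) (seq u j) (seq (limit I) j) η))
        where
        eq : ∀ ui u x η → ui ℚ.+ η ℚ.+ x ℚ.- (u ℚ.+ (ui ℚ.+ (η ℚ.+ η))) ≡ x ℚ.- (u ℚ.+ η)
        eq = solve-∀ ℚ-ring
      below : ∀ {v} I → Settled v η i → ThinInterval.right I ≡ seq v i ℚ.- (η ℚ.+ η) → limit I < v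
      below {v} I sv refl = mk< η 0<η (i , λ j i≤j → ≤-by
        (proj₁ (sv j i≤j) ⊹ limit≤right I ℕ.z≤n)
        (eq (seq v i) (seq v j) (seq (limit I) j) η))
        where
        eq : ∀ vi v x η → v ℚ.+ η ℚ.+ (vi ℚ.- (η ℚ.+ η)) ℚ.- (vi ℚ.+ x) ≡ v ℚ.- (x ℚ.+ η)
        eq = solve-∀ ℚ-ring
      refute : not (∃[ I ] (ThinInterval.left I ≡ U × ThinInterval.right I ≡ V ⊎
                         ThinInterval.left I ≡ U′ × ThinInterval.right I ≡ V′))
      refute (I , inj₁ (l , r)) = thin⇒∉ I (⊆X (above I su l) (below I sv r))
      refute (I , inj₂ (l , r)) = thin⇒∉ I (⊆X′ (above I su′ l) (below I sv′ r))

-- Outer measure of two intervals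

hasSum-eventually : ∀ {f s} → Eventually (λ n → partialSum f n ≈ s) → HasSum f s
hasSum-eventually {f} {s} sums ε 0<ε = eventually-map
  (λ {n} (≤s , s≤) → ≤-<-trans ≤s (x<x+ε s {ε} 0<ε) , ≤-<-trans s≤ (x<x+ε (partialSum f n) {ε} 0<ε)) sums

partialSum-two : ∀ f → (∀ n i → seq (f (suc (suc n))) i ≡ 0ℚ) →
  ∀ n → partialSum f (suc (suc n)) ≈ f 0 + f 1
partialSum-two f f≡0 n = pointwise-≈ {partialSum f (suc (suc n))} {f 0 + f 1} (sums n)
  where
  sums : ∀ n i → seq (partialSum f (suc (suc n))) i ≡ seq (f 0) i ℚ.+ seq (f 1) i
  sums zero    i = cong (ℚ._+ seq (f 1) i) (ℚ.+-identityˡ (seq (f 0) i))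
  sums (suc n) i = trans (cong (seq (partialSum f (suc (suc n))) i ℚ.+_) (f≡0 n i))
    (trans (ℚ.+-identityʳ (seq (partialSum f (suc (suc n))) i)) (sums n i))

hasSum-two : ∀ f → (∀ n i → seq (f (suc (suc n))) i ≡ 0ℚ) → HasSum f (f 0 + f 1)
hasSum-two f f≡0 = hasSum-eventually {f} {f 0 + f 1}
  (2 , λ { (suc (suc n)) (ℕ.s≤s (ℕ.s≤s _)) → partialSum-two f f≡0 n })

-- Serves for the lower and the upper ends alike, so the members from index 2 on are empty intervals
-- of length zero.
pair : ℝ → ℝ → ℕ → ℝ
pair x y 0             = x
pair x y 1             = y
pair x y (suc (suc _)) = 0ℝ

len≡hi-lo : ∀ {X} (C : Cover X) n → Cover.len C n ≡ Cover.hi C n - Cover.lo C n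
len≡hi-lo C n = refl

coverByTwo-sum : ∀ {X l₁ h₁ l₂ h₂} (C : Cover X) →
  Cover.lo C 0 ≡ l₁ → Cover.hi C 0 ≡ h₁ → Cover.lo C 1 ≡ l₂ → Cover.hi C 1 ≡ h₂ →
  (∀ n i → seq (Cover.len C (suc (suc n))) i ≡ 0ℚ) →
  HasSum (Cover.len C) ((h₁ - l₁) + (h₂ - l₂))
coverByTwo-sum C refl refl refl refl len≡0 =
  subst (HasSum (Cover.len C)) (cong₂ _+_ (len≡hi-lo C 0) (len≡hi-lo C 1)) (hasSum-two (Cover.len C) len≡0)

coverByTwo : ∀ {X l₁ h₁ l₂ h₂} → l₁ ≤ h₁ → l₂ ≤ h₂ →
  (∀ {x} → X x → l₁ < x × x < h₁ ⊎ l₂ < x × x < h₂) →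
  CoverLength X ((h₁ - l₁) + (h₂ - l₂))
coverByTwo {X} {l₁} {h₁} {l₂} {h₂} l₁≤h₁ l₂≤h₂ X⊆ =
  cover , coverByTwo-sum {X} {l₁} {h₁} {l₂} {h₂} cover refl refl refl refl (λ _ _ → refl)
  where
  lo≤hi : ∀ n → pair l₁ l₂ n ≤ pair h₁ h₂ n
  lo≤hi 0             = l₁≤h₁
  lo≤hi 1             = l₂≤h₂
  lo≤hi (suc (suc _)) = ≤-refl
  covers : ∀ {x} → l₁ < x × x < h₁ ⊎ l₂ < x × x < h₂ → ∃[ n ] (pair l₁ l₂ n < x × x < pair h₁ h₂ n)
  covers (inj₁ in₁) = 0 , in₁
  covers (inj₂ in₂) = 1 , in₂
  cover : Cover X
  cover = record { lo = pair l₁ l₂ ; hi = pair h₁ h₂ ; lo≤hi = lo≤hi ; covers = λ x∈X → covers (X⊆ x∈X) }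

Near : ℝ → ℝ → ℝ → Pred ℝ 0ℓ
Near δ l h x = l - δ < x × x < h + δ

≤×≤⇒Near : ∀ {l h x δ} → 0ℝ < δ → l ≤ x → x ≤ h → Near δ l h x
≤×≤⇒Near {l} {h} {x} {δ} 0<δ l≤x x≤h = <-≤-trans (x-δ<x l {δ} 0<δ) l≤x , ≤-<-trans x≤h (x<x+ε h {δ} 0<δ)

-- A point of b¹ need not be comparable with a, so a point of X is only asked to
-- be within δ of one of the closed intervals, for every δ > 0.
outerMeasure : ∀ {X l₁ h₁ l₂ h₂ m} → l₁ ≤ h₁ → h₁ ≤ l₂ → l₂ ≤ h₂ →
  (∀ {x} → l₁ < x → x < h₁ → X x) → (∀ {x} → l₂ < x → x < h₂ → X x) →
  (∀ {x} → X x → ∀ {δ} → 0ℝ < δ → Near δ l₁ h₁ x ⊎ Near δ l₂ h₂ x) →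
  m ≈ (h₁ - l₁) + (h₂ - l₂) → IsOuterMeasure X m
outerMeasure {X} {l₁} {h₁} {l₂} {h₂} {m} l₁≤h₁ h₁≤l₂ l₂≤h₂ ⊆₁ ⊆₂ near (m≤ , ≤m) =
  (λ s c → ≤-trans m≤ (coverLength≥ c h₁≤l₂ ⊆₁ ⊆₂)) , approximate
  where
  wider : ∀ {l h δ} → l ≤ h → 0ℝ < δ → l - δ ≤ h + δ
  wider {l} {h} {δ} l≤h 0<δ = ≤-trans (<⇒≤ (x-δ<x l {δ} 0<δ)) (≤-trans l≤h (<⇒≤ (x<x+ε h {δ} 0<δ)))
  approximate : ∀ ε → 0ℝ < ε → ∃[ s ] (CoverLength X s × s < m + ε)
  approximate ε (mk< γ 0<γ 0<ε) =
    (h₁ + δ - (l₁ - δ)) + (h₂ + δ - (l₂ - δ)) ,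
    coverByTwo (wider l₁≤h₁ 0<δ) (wider l₂≤h₂ 0<δ) (λ x∈X → near x∈X 0<δ) ,
    <-byℝ (+-mono-≤-< ≤m ½γ<ε) λ n → eq (seq l₁ n) (seq h₁ n) (seq l₂ n) (seq h₂ n) (seq m n) (seq ε n) γ
    where
    -- An eighth of `γ`: widening at four ends adds `γ / 2`, which is strictly below `ε`.
    δ = fromℚ (halvings γ 3)
    0<δ : 0ℝ < δ
    0<δ = fromℚ>0 (halvings>0 0<γ 3)
    ½γ<ε : fromℚ (½ ℚ.* γ) < ε
    ½γ<ε = mk< (½ ℚ.* γ) (half>0 0<γ) (eventually-map (λ {n} p → ≤-by p (eq (seq ε n) γ)) 0<ε)
      where
      eq : ∀ ε γ → ε ℚ.- (0ℚ ℚ.+ γ) ≡ ε ℚ.- (½ ℚ.* γ ℚ.+ ½ ℚ.* γ)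
      eq = solve-∀ ℚ-ring
    eq : ∀ l₁ h₁ l₂ h₂ m ε γ → let δ = ½ ℚ.* (½ ℚ.* (½ ℚ.* γ)) in
      m ℚ.+ ε ℚ.- ((h₁ ℚ.- l₁) ℚ.+ (h₂ ℚ.- l₂) ℚ.+ ½ ℚ.* γ) ≡
      m ℚ.+ ε ℚ.- ((h₁ ℚ.+ δ ℚ.- (l₁ ℚ.- δ)) ℚ.+ (h₂ ℚ.+ δ ℚ.- (l₂ ℚ.- δ)))
    eq = solve-∀ ℚ-ring

-- Measurability of the unions and complements

∪-measurable : UnionsMeasurable
∪-measurable {a} {b} (0≤a , a≤1) (0≤b , b≤1) = record
  { X⊆[0,1]    = ⊆[0,1]
  ; value      = m
  ; outer      = outerMeasure {a ⁰ ∪ b ¹} {0ℝ} {a} {r} {1ℝ} {m} 0≤a a≤r r≤1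
                   (λ 0<x x<a → inj₁ (<⇒≤ 0<x , <⇒≤ x<a))
                   (λ r<x x<1 → inj₂ (≤-trans 1-b≤r (<⇒≤ r<x) , <⇒≤ x<1)) near
                   (pointwise-≈ {m} {(a - 0ℝ) + (1ℝ - r)} λ n → eq₁ (seq a n) (seq m n))
  -- The complement is a single interval, so the second one is the degenerate `[r , r]`, whose empty
  -- interior `<-contradiction` disposes of.
  ; outerCompl = outerMeasure {[0,1] ∖ (a ⁰ ∪ b ¹)} {a} {r} {r} {r} {1ℝ - m} a≤r ≤-refl ≤-refl
                   (λ a<x x<r → (≤-trans 0≤a (<⇒≤ a<x) , ≤-trans (<⇒≤ x<r) r≤1) ,
                     λ { (inj₁ (_ , x≤a)) → <⇒≱ a<x x≤a
                       ; (inj₂ (1-b≤x , _)) → <⇒≱ x<r (r≤x (<⇒≤ a<x) 1-b≤x) })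
                   <-contradiction
                   (λ {x} ((0≤x , x≤1) , x∉X) 0<δ → inj₁ (≤×≤⇒Near 0<δ
                     (≰⇒≥ λ x≤a → x∉X (inj₁ (0≤x , x≤a)))
                     (≤-trans (≰⇒≥ λ 1-b≤x → x∉X (inj₂ (1-b≤x , x≤1))) 1-b≤r)))
                   (pointwise-≈ {1ℝ - m} {(r - a) + (r - r)} λ n → eq₂ (seq a n) (seq m n))
  }
  where
  m r : ℝ
  m = 1ℝ ⊓ (a + b)
  -- Defining the maximum through `m` makes every comparison with `r` a linear consequence of one
  -- with `m`, and makes the two lengths sum to `m` entrywise.
  r = 1ℝ + a - m
  a≤m : a ≤ m
  a≤m = ⊓-glb {1ℝ} {a + b} {a} a≤1 (≤-byℝ 0≤b λ n → eq (seq a n) (seq b n))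
    where
    eq : ∀ a b → b ℚ.- 0ℚ ≡ a ℚ.+ b ℚ.- a
    eq = solve-∀ ℚ-ring
  a≤r : a ≤ r
  a≤r = ≤-byℝ (x⊓y≤x 1ℝ (a + b)) λ n → eq (seq a n) (seq m n)
    where
    eq : ∀ a m → 1ℚ ℚ.- m ≡ 1ℚ ℚ.+ a ℚ.- m ℚ.- a
    eq = solve-∀ ℚ-ring
  r≤1 : r ≤ 1ℝ
  r≤1 = ≤-byℝ a≤m λ n → eq (seq a n) (seq m n)
    where
    eq : ∀ a m → m ℚ.- a ≡ 1ℚ ℚ.- (1ℚ ℚ.+ a ℚ.- m)
    eq = solve-∀ ℚ-ring
  1-b≤r : 1ℝ - b ≤ r
  1-b≤r = ≤-byℝ (x⊓y≤y 1ℝ (a + b)) λ n → eq (seq a n) (seq b n) (seq m n)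
    where
    eq : ∀ a b m → a ℚ.+ b ℚ.- m ≡ 1ℚ ℚ.+ a ℚ.- m ℚ.- (1ℚ ℚ.- b)
    eq = solve-∀ ℚ-ring
  r≤x : ∀ {x} → a ≤ x → 1ℝ - b ≤ x → r ≤ x
  r≤x {x} a≤x 1-b≤x = ≤-byℝ {1ℝ + a - x} {m}
    (⊓-glb {1ℝ} {a + b} {1ℝ + a - x} (≤-byℝ a≤x λ n → eq₁ (seq a n) (seq x n))
      (≤-byℝ 1-b≤x λ n → eq₂ (seq a n) (seq b n) (seq x n)))
    λ n → eq₃ (seq a n) (seq m n) (seq x n)
    where
    eq₁ : ∀ a x → x ℚ.- a ≡ 1ℚ ℚ.- (1ℚ ℚ.+ a ℚ.- x)
    eq₁ = solve-∀ ℚ-ring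
    eq₂ : ∀ a b x → x ℚ.- (1ℚ ℚ.- b) ≡ a ℚ.+ b ℚ.- (1ℚ ℚ.+ a ℚ.- x)
    eq₂ = solve-∀ ℚ-ring
    eq₃ : ∀ a m x → m ℚ.- (1ℚ ℚ.+ a ℚ.- x) ≡ x ℚ.- (1ℚ ℚ.+ a ℚ.- m)
    eq₃ = solve-∀ ℚ-ring
  ⊆[0,1] : ∀ {x} → x ∈ a ⁰ ∪ b ¹ → x ∈ [0,1]
  ⊆[0,1] (inj₁ (0≤x , x≤a))   = 0≤x , ≤-trans x≤a a≤1
  ⊆[0,1] (inj₂ (1-b≤x , x≤1)) = ≤-trans (≤⇒0≤- {b} {1ℝ} b≤1) 1-b≤x , x≤1
  near : ∀ {x} → x ∈ a ⁰ ∪ b ¹ → ∀ {δ} → 0ℝ < δ → Near δ 0ℝ a x ⊎ Near δ r 1ℝ x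
  near (inj₁ (0≤x , x≤a)) 0<δ = inj₁ (≤×≤⇒Near 0<δ 0≤x x≤a)
  -- Cotransitivity replaces the undecidable comparison of `x` with `a`: beyond `a` the point is at
  -- least `r`, and otherwise it is within `δ` of `a ⁰`.
  near {x} x∈@(inj₂ (1-b≤x , x≤1)) {δ} 0<δ = side (<-cotrans (x<x+ε a {δ} 0<δ) x)
    where
    side : a < x ⊎ x < a + δ → Near δ 0ℝ a x ⊎ Near δ r 1ℝ x
    side (inj₁ a<x)   = inj₂ (≤×≤⇒Near 0<δ (r≤x (<⇒≤ a<x) 1-b≤x) x≤1)
    side (inj₂ x<a+δ) = inj₁ (proj₁ (≤×≤⇒Near 0<δ (proj₁ (⊆[0,1] x∈)) ≤-refl) , x<a+δ)
  eq₁ : ∀ a m → m ≡ (a ℚ.- 0ℚ) ℚ.+ (1ℚ ℚ.- (1ℚ ℚ.+ a ℚ.- m))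
  eq₁ = solve-∀ ℚ-ring
  eq₂ : ∀ a m → let r = 1ℚ ℚ.+ a ℚ.- m in 1ℚ ℚ.- m ≡ (r ℚ.- a) ℚ.+ (r ℚ.- r)
  eq₂ = solve-∀ ℚ-ring

∖-measurable : ComplementsMeasurable
∖-measurable {a} (0≤a , a≤1) = record
  { X⊆[0,1]    = proj₁
  ; value      = 1ℝ - a
  ; outer      = outerMeasure {[0,1] ∖ a ⁰} {a} {1ℝ} {1ℝ} {1ℝ} {1ℝ - a} a≤1 ≤-refl ≤-refl
                   (λ a<x x<1 → (≤-trans 0≤a (<⇒≤ a<x) , <⇒≤ x<1) , λ (_ , x≤a) → <⇒≱ a<x x≤a)
                   <-contradiction
                   (λ ((0≤x , x≤1) , x∉a⁰) 0<δ → inj₁ (≤×≤⇒Near 0<δ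
                     (≰⇒≥ λ x≤a → x∉a⁰ (0≤x , x≤a)) x≤1))
                   (pointwise-≈ {1ℝ - a} {(1ℝ - a) + (1ℝ - 1ℝ)} λ n → eq₁ (seq a n))
  ; outerCompl = outerMeasure {[0,1] ∖ ([0,1] ∖ a ⁰)} {0ℝ} {a} {a} {a} {1ℝ - (1ℝ - a)} 0≤a ≤-refl ≤-refl
                   (λ 0<x x<a → (<⇒≤ 0<x , ≤-trans (<⇒≤ x<a) a≤1) ,
                     λ (_ , x∉a⁰) → x∉a⁰ (<⇒≤ 0<x , <⇒≤ x<a))
                   <-contradiction
                   (λ ((0≤x , x≤1) , ¬x∉a⁰) 0<δ → inj₁ (≤×≤⇒Near 0<δ 0≤x
                     -- The double complement gives back `x ≤ a` because weak inequality is stable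
                     -- under double negation.
                     (≮⇒≥ λ a<x → ¬x∉a⁰ ((0≤x , x≤1) , λ (_ , x≤a) → <⇒≱ a<x x≤a))))
                   (pointwise-≈ {1ℝ - (1ℝ - a)} {(a - 0ℝ) + (a - a)} λ n → eq₂ (seq a n))
  }
  where
  eq₁ : ∀ a → 1ℚ ℚ.- a ≡ (1ℚ ℚ.- a) ℚ.+ (1ℚ ℚ.- 1ℚ)
  eq₁ = solve-∀ ℚ-ring
  eq₂ : ∀ a → 1ℚ ℚ.- (1ℚ ℚ.- a) ≡ (a ℚ.- 0ℚ) ℚ.+ (a ℚ.- a)
  eq₂ = solve-∀ ℚ-ring

-- MV-algebra operations on indices

Icc-mono : ∀ {a b c} → b ≤ c → Icc a b ⊆ Icc a c
Icc-mono b≤c (a≤x , x≤b) = a≤x , ≤-trans x≤b b≤c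

-- The index of `S` is itself a point of `S`, hence of `T`, where it is bounded by the index of `T`.
index-mono : ∀ S T → set S ⊆ set T → index S ≤ index T
index-mono S T S⊆T =
  proj₂ (proj₁ (set≐index⁰ T) (S⊆T (proj₂ (set≐index⁰ S) (proj₁ (index∈[0,1] S) , ≤-refl))))

index-cong : ∀ S T → S ≈₀ T → index S ≈ index T
index-cong S T (S⊆T , T⊆S) = index-mono S T S⊆T , index-mono T S T⊆S

set-mono : ∀ S T → index S ≤ index T → set S ⊆ set T
set-mono S T s≤t x∈S = proj₂ (set≐index⁰ T) (Icc-mono s≤t (proj₁ (set≐index⁰ S) x∈S))

index-injective : ∀ S T → index S ≈ index T → S ≈₀ T
index-injective S T (s≤t , t≤s) = set-mono S T s≤t , set-mono T S t≤s

infixl 6 _⊞_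

_⊞_ : ℝ → ℝ → ℝ
x ⊞ y = 1ℝ ⊓ (x + y)

⊞-mono : ∀ {x y z w} → x ≤ y → z ≤ w → x ⊞ z ≤ y ⊞ w
⊞-mono {x} {y} {z} {w} x≤y z≤w = ⊓-mono-≤ {1ℝ} {1ℝ} {x + z} {y + w} ≤-refl (+-mono-≤ x≤y z≤w)

⊞-cong : ∀ {x y z w} → x ≈ y → z ≈ w → x ⊞ z ≈ y ⊞ w
⊞-cong (x≤y , y≤x) (z≤w , w≤z) = ⊞-mono x≤y z≤w , ⊞-mono y≤x w≤z

⊞-comm : ∀ x y → x ⊞ y ≈ y ⊞ x
⊞-comm x y = pointwise-≈ {x ⊞ y} {y ⊞ x} λ n → cong (1ℚ ℚ.⊓_) (ℚ.+-comm (seq x n) (seq y n))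

-- For `y ≥ 0` the outer truncation absorbs the inner one: `t = x ⊞ y` satisfies `t - y ≤ 1` and
-- `t - y ≤ x`. No case distinction on `x` is made.
⊞-truncateˡ : ∀ x {y} → 0ℝ ≤ y → (1ℝ ⊓ x) ⊞ y ≈ x ⊞ y
⊞-truncateˡ x {y} 0≤y = ⊞-mono {1ℝ ⊓ x} {x} {y} {y} (x⊓y≤y 1ℝ x) ≤-refl ,
  ⊓-glb {1ℝ} {(1ℝ ⊓ x) + y} {t} (x⊓y≤x 1ℝ (x + y))
    (≤-byℝ {t - y} {1ℝ ⊓ x} t-y≤ λ n → eq₃ (seq t n) (seq y n) (seq (1ℝ ⊓ x) n))
  where
  t : ℝ
  t = x ⊞ y
  eq₁ : ∀ t y → 1ℚ ℚ.+ y ℚ.- (t ℚ.+ 0ℚ) ≡ 1ℚ ℚ.- (t ℚ.- y)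
  eq₁ = solve-∀ ℚ-ring
  eq₂ : ∀ t x y → x ℚ.+ y ℚ.- t ≡ x ℚ.- (t ℚ.- y)
  eq₂ = solve-∀ ℚ-ring
  eq₃ : ∀ t y m → m ℚ.- (t ℚ.- y) ≡ m ℚ.+ y ℚ.- t
  eq₃ = solve-∀ ℚ-ring
  t-y≤ : t - y ≤ 1ℝ ⊓ x
  t-y≤ = ⊓-glb {1ℝ} {x} {t - y}
    (≤-byℝ (+-mono-≤ (x⊓y≤x 1ℝ (x + y)) 0≤y) λ n → eq₁ (seq t n) (seq y n))
    (≤-byℝ (x⊓y≤y 1ℝ (x + y)) λ n → eq₂ (seq t n) (seq x n) (seq y n))

-- Both sides are the truncation of the triple sum; the right one reaches it after commuting `x` to
-- the end.
⊞-assoc : ∀ x y z → 0ℝ ≤ x → 0ℝ ≤ z → (x ⊞ y) ⊞ z ≈ x ⊞ (y ⊞ z)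
⊞-assoc x y z 0≤x 0≤z =
  ≈-trans {(x ⊞ y) ⊞ z} {(x + y) ⊞ z} {x ⊞ (y ⊞ z)} (⊞-truncateˡ (x + y) 0≤z)
  (≈-trans {(x + y) ⊞ z} {(y + z) ⊞ x} {x ⊞ (y ⊞ z)}
    (pointwise-≈ {(x + y) ⊞ z} {(y + z) ⊞ x} λ n → cong (1ℚ ℚ.⊓_) (eq (seq x n) (seq y n) (seq z n)))
  (≈-trans {(y + z) ⊞ x} {(y ⊞ z) ⊞ x} {x ⊞ (y ⊞ z)}
    (≈-sym {(y ⊞ z) ⊞ x} {(y + z) ⊞ x} (⊞-truncateˡ (y + z) 0≤x))
    (⊞-comm (y ⊞ z) x)))
  where
  eq : ∀ x y z → x ℚ.+ y ℚ.+ z ≡ y ℚ.+ z ℚ.+ x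
  eq = solve-∀ ℚ-ring

⊞-identityˡ : ∀ x → x ≤ 1ℝ → 0ℝ ⊞ x ≈ x
⊞-identityˡ x x≤1 = ≤-trans {0ℝ ⊞ x} {0ℝ + x} {x} (x⊓y≤y 1ℝ (0ℝ + x)) (proj₁ 0+x≈x) ,
  ⊓-glb {1ℝ} {0ℝ + x} {x} x≤1 (proj₂ 0+x≈x)
  where
  0+x≈x : 0ℝ + x ≈ x
  0+x≈x = pointwise-≈ {0ℝ + x} {x} λ n → ℚ.+-identityˡ (seq x n)

⊞-zeroˡ : ∀ x → 0ℝ ≤ x → 1ℝ ⊞ x ≈ 1ℝ
⊞-zeroˡ x 0≤x = x⊓y≤x 1ℝ (1ℝ + x) ,
  ⊓-glb {1ℝ} {1ℝ + x} {1ℝ} ≤-refl (≤-byℝ {0ℝ} {x} 0≤x λ n → eq (seq x n))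
  where
  eq : ∀ x → x ℚ.- 0ℚ ≡ 1ℚ ℚ.+ x ℚ.- 1ℚ
  eq = solve-∀ ℚ-ring

⊞-zeroʳ : ∀ x → 0ℝ ≤ x → x ⊞ (1ℝ - 0ℝ) ≈ 1ℝ - 0ℝ
⊞-zeroʳ x 0≤x =
  ≈-trans {x ⊞ (1ℝ - 0ℝ)} {(1ℝ - 0ℝ) ⊞ x} {1ℝ - 0ℝ} (⊞-comm x (1ℝ - 0ℝ))
  (≈-trans {(1ℝ - 0ℝ) ⊞ x} {1ℝ ⊞ x} {1ℝ - 0ℝ} (⊞-cong {1ℝ - 0ℝ} {1ℝ} {x} {x} 1-0≈1 (≤-refl , ≤-refl))
  (≈-trans {1ℝ ⊞ x} {1ℝ} {1ℝ - 0ℝ} (⊞-zeroˡ x 0≤x) (≈-sym {1ℝ - 0ℝ} {1ℝ} 1-0≈1)))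
  where
  1-0≈1 : 1ℝ - 0ℝ ≈ 1ℝ
  1-0≈1 = pointwise-≈ {1ℝ - 0ℝ} {1ℝ} λ _ → refl

1--cong : ∀ {x y} → x ≈ y → 1ℝ - x ≈ 1ℝ - y
1--cong {x} {y} (x≤y , y≤x) = anti y≤x , anti x≤y
  where
  eq : ∀ x y → x ℚ.- y ≡ 1ℚ ℚ.- y ℚ.- (1ℚ ℚ.- x)
  eq = solve-∀ ℚ-ring
  anti : ∀ {x y} → y ≤ x → 1ℝ - x ≤ 1ℝ - y
  anti {x} {y} y≤x = ≤-byℝ {y} {x} y≤x λ n → eq (seq x n) (seq y n)

1--involutive : ∀ x → 1ℝ - (1ℝ - x) ≈ x
1--involutive x = pointwise-≈ {1ℝ - (1ℝ - x)} {x} λ n → eq (seq x n)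
  where
  eq : ∀ x → 1ℚ ℚ.- (1ℚ ℚ.- x) ≡ x
  eq = solve-∀ ℚ-ring

-- The source of the symmetry in Łukasiewicz's axiom: `¬ (¬ p ⊕ q) ⊕ q` computes the maximum.
-- Rational order is total, so the two cases may be checked separately.
p⊔q-truncated : ∀ p q → 1ℚ ℚ.- 1ℚ ℚ.⊓ (1ℚ ℚ.- p ℚ.+ q) ℚ.+ q ≡ p ℚ.⊔ q
p⊔q-truncated p q with ℚ.≤-total p q
... | inj₁ p≤q = trans (cong (λ m → 1ℚ ℚ.- m ℚ.+ q) (ℚ.p≤q⇒p⊓q≡p {1ℚ} {1ℚ ℚ.- p ℚ.+ q} (≤-by p≤q (eq p q))))
                   (trans (ℚ.+-identityˡ q) (sym (ℚ.p≤q⇒p⊔q≡q p≤q)))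
  where
  eq : ∀ p q → q ℚ.- p ≡ 1ℚ ℚ.- p ℚ.+ q ℚ.- 1ℚ
  eq = solve-∀ ℚ-ring
... | inj₂ q≤p = trans (cong (λ m → 1ℚ ℚ.- m ℚ.+ q) (ℚ.p≥q⇒p⊓q≡q {1ℚ} {1ℚ ℚ.- p ℚ.+ q} (≤-by q≤p (eq p q))))
                   (trans (eq′ p q) (sym (ℚ.p≥q⇒p⊔q≡p q≤p)))
  where
  eq : ∀ p q → p ℚ.- q ≡ 1ℚ ℚ.- (1ℚ ℚ.- p ℚ.+ q)
  eq = solve-∀ ℚ-ring
  eq′ : ∀ p q → 1ℚ ℚ.- (1ℚ ℚ.- p ℚ.+ q) ℚ.+ q ≡ p
  eq′ = solve-∀ ℚ-ring

-- Entry by entry both sides are the maximum cut off at 1, so no order decision on reals is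
-- involved.
⊞-łukasiewicz : ∀ x y → (1ℝ - ((1ℝ - x) ⊞ y)) ⊞ y ≈ (1ℝ - ((1ℝ - y) ⊞ x)) ⊞ x
⊞-łukasiewicz x y = pointwise-≈ {(1ℝ - ((1ℝ - x) ⊞ y)) ⊞ y} {(1ℝ - ((1ℝ - y) ⊞ x)) ⊞ x} λ n →
  cong (1ℚ ℚ.⊓_) (sides (seq x n) (seq y n))
  where
  sides : ∀ p q → 1ℚ ℚ.- 1ℚ ℚ.⊓ (1ℚ ℚ.- p ℚ.+ q) ℚ.+ q ≡ 1ℚ ℚ.- 1ℚ ℚ.⊓ (1ℚ ℚ.- q ℚ.+ p) ℚ.+ p
  sides p q = trans (p⊔q-truncated p q) (trans (ℚ.⊔-comm p q) (sym (p⊔q-truncated q p)))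

-- The operations are variables, lest conversion checking unfold the measures.
module ByIndex
  (_⊕_ : Op₂ 𝓘₀) (¬_ : Op₁ 𝓘₀)
  (index-⊕ : ∀ S T → index (S ⊕ T) ≡ index S ⊞ index T)
  (index-¬ : ∀ S → index (¬ S) ≡ 1ℝ - index S)
  where

  from-indices : ∀ S T {x y} → index S ≡ x → index T ≡ y → x ≈ y → S ≈₀ T
  from-indices S T refl refl = index-injective S T

  index-⊕-at : ∀ S T x y → index S ≡ x → index T ≡ y → index (S ⊕ T) ≡ x ⊞ y
  index-⊕-at S T _ _ refl refl = index-⊕ S T

  index-¬-at : ∀ S x → index S ≡ x → index (¬ S) ≡ 1ℝ - x
  index-¬-at S _ refl = index-¬ S

  ⊕-cong : ∀ S T U V → S ≈₀ T → U ≈₀ V → (S ⊕ U) ≈₀ (T ⊕ V)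
  ⊕-cong S T U V S≈T U≈V = from-indices (S ⊕ U) (T ⊕ V) (index-⊕ S U) (index-⊕ T V)
    (⊞-cong {index S} {index T} {index U} {index V} (index-cong S T S≈T) (index-cong U V U≈V))

  ⊕-comm : ∀ S T → (S ⊕ T) ≈₀ (T ⊕ S)
  ⊕-comm S T = from-indices (S ⊕ T) (T ⊕ S) (index-⊕ S T) (index-⊕ T S) (⊞-comm (index S) (index T))

  ⊕-assoc : ∀ S T U → ((S ⊕ T) ⊕ U) ≈₀ (S ⊕ (T ⊕ U))
  ⊕-assoc S T U = from-indices ((S ⊕ T) ⊕ U) (S ⊕ (T ⊕ U))
    (index-⊕-at (S ⊕ T) U (index S ⊞ index T) (index U) (index-⊕ S T) refl)
    (index-⊕-at S (T ⊕ U) (index S) (index T ⊞ index U) refl (index-⊕ T U))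
    (⊞-assoc (index S) (index T) (index U) (proj₁ (index∈[0,1] S)) (proj₁ (index∈[0,1] U)))

  ⊕-identityˡ : ∀ S → (𝟎 ⊕ S) ≈₀ S
  ⊕-identityˡ S = from-indices (𝟎 ⊕ S) S (index-⊕ 𝟎 S) refl (⊞-identityˡ (index S) (proj₂ (index∈[0,1] S)))

  ⊕-zeroˡ : ∀ S → (𝟏 ⊕ S) ≈₀ 𝟏
  ⊕-zeroˡ S = from-indices (𝟏 ⊕ S) 𝟏 (index-⊕ 𝟏 S) refl (⊞-zeroˡ (index S) (proj₁ (index∈[0,1] S)))

  ⊕-zeroʳ : ∀ S → (S ⊕ (¬ 𝟎)) ≈₀ (¬ 𝟎)
  ⊕-zeroʳ S = from-indices (S ⊕ (¬ 𝟎)) (¬ 𝟎)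
    (index-⊕-at S (¬ 𝟎) (index S) (1ℝ - 0ℝ) refl (index-¬ 𝟎)) (index-¬ 𝟎)
    (⊞-zeroʳ (index S) (proj₁ (index∈[0,1] S)))

  ¬-cong : ∀ S T → S ≈₀ T → (¬ S) ≈₀ (¬ T)
  ¬-cong S T S≈T = from-indices (¬ S) (¬ T) (index-¬ S) (index-¬ T)
    (1--cong {index S} {index T} (index-cong S T S≈T))

  ¬-involutive : ∀ S → (¬ (¬ S)) ≈₀ S
  ¬-involutive S = from-indices (¬ (¬ S)) S (index-¬-at (¬ S) (1ℝ - index S) (index-¬ S)) refl
    (1--involutive (index S))

  łukasiewicz : ∀ S T → ((¬ ((¬ S) ⊕ T)) ⊕ T) ≈₀ ((¬ ((¬ T) ⊕ S)) ⊕ S)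
  łukasiewicz S T = from-indices ((¬ ((¬ S) ⊕ T)) ⊕ T) ((¬ ((¬ T) ⊕ S)) ⊕ S) (indices S T) (indices T S)
    (⊞-łukasiewicz (index S) (index T))
    where
    indices : ∀ S T → index ((¬ ((¬ S) ⊕ T)) ⊕ T) ≡ (1ℝ - ((1ℝ - index S) ⊞ index T)) ⊞ index T
    indices S T =
      index-⊕-at (¬ ((¬ S) ⊕ T)) T (1ℝ - ((1ℝ - index S) ⊞ index T)) (index T)
        (index-¬-at ((¬ S) ⊕ T) ((1ℝ - index S) ⊞ index T)
          (index-⊕-at (¬ S) T (1ℝ - index S) (index T) (index-¬ S) refl))
        refl

  isMVAlgebra : IsMVAlgebra _≈₀_ _⊕_ ¬_ 𝟎 𝟏
  isMVAlgebra = record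
    { isCommutativeMonoid = isCommutativeMonoidˡ (record
      { isSemigroup = record
        { isMagma = record
          { isEquivalence = On.isEquivalence set ≐-isEquivalence
          ; ∙-cong        = λ {S} {T} {U} {V} → ⊕-cong S T U V
          }
        ; assoc = ⊕-assoc
        }
      ; identityˡ = ⊕-identityˡ
      ; comm      = ⊕-comm
      })
    ; ¬-cong       = λ {S} {T} → ¬-cong S T
    ; ¬-involutive = ¬-involutive
    ; 1-zeroˡ      = ⊕-zeroˡ
    ; ¬0-zeroʳ     = ⊕-zeroʳ
    ; łukasiewicz  = łukasiewicz
    }

theorem3 : Σ[ ∪-meas ∈ UnionsMeasurable ] Σ[ ∖-meas ∈ ComplementsMeasurable ]
    (let open Operations ∪-meas ∖-meas in
    IsMVAlgebra _≈₀_ _⊕_ ¬_ 𝟎 𝟏)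
-- The index of a result is the measure stored in the measurability proof, which is `a ⊞ b` or
-- `1ℝ - a` by definition; hence `refl`.
theorem3 = ∪-measurable , ∖-measurable , ByIndex.isMVAlgebra _⊕_ ¬_ (λ _ _ → refl) (λ _ → refl)
  where open Operations ∪-measurable ∖-measurable
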